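{- Let $S_0,S_1,\ldots$ be a fair theorem proving derivation with respect to the inference system $\mathfrak{S}$, where each $S_i$ is a set of clauses over $\Sigma^*$. Then $S_0$ is unsatisfiable if and only if the empty clause is in some $S_j$.
   Context: **Strings and clauses.** $\Sigma$ is a finite alphabet with a total precedence, $\Sigma^*$ is the set of strings over $\Sigma$, $\lambda$ is the empty string. An equation is $s\approx t$ with $s,t\in\Sigma^*$ (unoriented: $s\approx t$ and $t\approx s$ are identified, likewise $s\not\approx t$ and $t\not\approx s$). A literal is an equation $s\approx t$ (positive) or a negated equation $s\not\approx t$ (negative). A clause over $\Sigma^*$ is a finite multiset of literals, written as a disjunction; $\square$ is the empty clause. $\succ$ is the length-lexicographic ordering on $\Sigma^*$: $s\succ t$ iff $|s|>|t|$, or $|s|=|t|$ and $s$ is larger than $t$ in the lexicographic order induced by the precedence. $\bowtie$ denotes either $\approx$ or $\not\approx$. **Selection.** A fixed selection function selects (arbitrarily) exactly one negative literal in each clause containing at least one negative literal. **Inference system $\mathfrak{S}$.** It consists of the following rules. - Superposition: from $C\vee u_1u_2\approx s$ and $D\vee u_2u_3\approx t$ infer $C\vee D\vee u_1t\approx su_3$, if $u_2\neq\lambda$, $C$ and $D$ contain no selected literal, $u_1u_2\succ s$, $u_2u_3\succ t$. - Rewrite: from $C\vee u_1u_2u_3\bowtie s$ and $D\vee u_2\approx t$ infer $C\vee D\vee u_1tu_3\bowtie s$, if $u_1u_2u_3\bowtie s$ is selected in the left premise whenever $\bowtie$ is $\not\approx$, $C$ contains no selected literal whenever $\bowtie$ is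 $\approx$, $D$ contains no selected literal, $u_2\succ t$. - Equality Resolution: from $C\vee s\not\approx s$ infer $C$, if $s\not\approx s$ is selected in the premise. - Paramodulation: from $C\vee s\approx u_1u_2$ and $D\vee u_2u_3\approx t$ infer $C\vee D\vee su_3\approx u_1t$, if $u_2\ne\lambda$, $C$ contains no selected literal, $C$ contains a positive literal, $D$ contains no selected literal, $s\succ u_1u_2$, $u_2u_3\succ t$. - Factoring: from $C\vee s\approx t\vee su\approx tu$ infer $C\vee su\approx tu$, if $C$ contains no selected literal. **$g$-terms and $g$-clauses.** $T(\Sigma\cup\{\bot\})$ is the set of ground terms with each letter of $\Sigma$ a unary function symbol and $\bot$ the only constant; its elements ($g$-terms) are written as strings $u\bot$ with $u\in\Sigma^*$. For a clause $C=s_1\approx t_1\vee\cdots\vee s_m\approx t_m\vee u_1\not\approx v_1\vee\cdots\vee u_n\not\approx v_n$ over $\Sigma^*$, a $g$-clause of $C$ is any $s_1w_1\bot\approx t_1w_1\bot\vee\cdots\vee s_mw_m\bot\approx t_mw_m\bot\vee u_1\bot\not\approx v_1\bot\vee\cdots\vee u_n\bot\not\approx v_n\bot$ with $w_1,\ldots,w_m\in\Sigma^*$. $\succ_g$ is the length-lexicographic ordering on $g$-terms (precedence on $\Sigma$ extended with $\bot$ minimal), extended to literals and clauses by multiset extension, where $s\approx t$ is identified with $\{\{s\},\{t\}\}$, $s\not\approx t$ with $\{\{s,t\}\}$, and a clause with the multiset of its literals. **Semantics.** An (equality Herbrand) interpretation is a congruence $I$ on $T(\Sigma\cup\{\bot\})$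 (the one generated by some set of equations between $g$-terms). It satisfies a $g$-clause if some positive literal $p\approx q$ of it has $(p,q)\in I$ or some negative literal $p\not\approx q$ has $(p,q)\notin I$. $I$ satisfies a clause over $\Sigma^*$ if it satisfies all its $g$-clauses, and a set of clauses if it satisfies every member. A set of clauses is satisfiable if some interpretation satisfies it. For $g$-clauses, $\{C_1,\ldots,C_k\}\models C$ means every interpretation satisfying all $C_i$ satisfies $C$. **$g$-instances and redundancy.** A $g$-instance of an inference $\pi$ of $\mathfrak{S}$ with premises $C_1,\ldots,C_k$ and conclusion $D$ is an inference of $\mathfrak{S}$ with premises $C_1',\ldots,C_k'$ and conclusion $D'$ that are $g$-clauses of $C_1,\ldots,C_k,D$; here $g$-terms are viewed as strings over $\Sigma\cup\{\bot\}$, $\succ_g$ is used in place of $\succ$, all terms occurring must be $g$-terms, and a negative literal of $C_i'$ is selected iff the literal of $C_i$ it comes from is. A $g$-clause $C$ is redundant w.r.t. a set $S$ of clauses over $\Sigma^*$ if there are $g$-clauses $C_1',\ldots,C_k'$ ($k\ge0$) of clauses in $S$ with $\{C_1',\ldots,C_k'\}\models C$ and $C\succ_g C_i'$ for all $i$. A clause is redundant w.r.t. $S$ if all its $g$-clauses are. An inference $\pi$ is redundant w.r.t. $S$ if for every $g$-instance of $\pi$ with maximal premise $C'$ (w.r.t. $\succ_g$) and conclusion $D'$ there are $g$-clauses $C_1',\ldots,C_k'$ of clauses in $S$ with $\{C_1',\ldots,C_k'\}\models D'$ and $C'\succ_g C_i'$ for all $i$. **Derivations.** A theorem proving derivation is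 a sequence $S_0,S_1,\ldots$ of sets of clauses over $\Sigma^*$ such that each $S_i$ ($i\geq 1$) is either $S_{i-1}\cup\{C\}$ where $C$ is the conclusion of an inference of $\mathfrak{S}$ with premises in $S_{i-1}$ (Deduction), or $S_{i-1}\setminus\{D\}$ where $D$ is redundant w.r.t. $S_{i-1}$ (Deletion). Its limit is $S_\infty=\bigcup_i\bigcap_{j\ge i}S_j$. It is fair w.r.t. $\mathfrak{S}$ if every inference of $\mathfrak{S}$ with premises in $S_\infty$ is redundant w.r.t. $\bigcup_jS_j$. -}

module Defs where

open import Level using (0ℓ)
open import Data.List.Base using (List; []; _∷_; _++_; [_]; map; foldr; length)
open import Data.List.Membership.Propositional using () renaming (_∈_ to _∈ₗ_)
open import Data.List.Relation.Binary.Lex.Strict using (Lex-<)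
open import Data.List.Relation.Binary.Pointwise.Base using (Pointwise)
import Data.List.Relation.Binary.Permutation.Setoid as Permutation
open import Data.List.Relation.Unary.All using (All)
open import Data.List.Relation.Unary.Any using (Any)
open import Data.List.Relation.Unary.Enumerates.Setoid using (IsEnumeration)
open import Data.Nat.Base using (ℕ; suc; _≤_; _<_)
open import Data.Product.Base using (∃-syntax; Σ-syntax; _×_)
open import Data.Sum.Base using (_⊎_)
open import Function.Base using (id)
open import Relation.Binary.Bundles using (Setoid)
open import Relation.Binary.Core using (Rel)
open import Relation.Binary.Structures using (IsEquivalence; IsStrictTotalOrder)
open import Relation.Binary.PropositionalEquality using (_≡_; _≢_; refl; setoid)
open import Relation.Binary.Construct.Add.Infimum.Strict using (_<₋_)
open import Relation.Nullary.Construct.Add.Infimum using (_₋; ⊥₋) renaming ([_] to letter)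
open import Relation.Nullary.Negation.Core using (¬_)
open import Relation.Unary using (Pred; _∈_; _≐_; _∪_; _∖_; ⋃)
open import Relation.Binary.Definitions using (_Respects_)

data Polarity : Set where
  pos neg : Polarity

record Literal (T : Set) : Set where
  constructor lit
  field
    polarity : Polarity
    lhs rhs  : T

infix 4 _≈_ _≉_
pattern _≈_ s t = lit pos s t
pattern _≉_ s t = lit neg s t

Positive Negative : {T : Set} → Pred (Literal T) 0ℓ
Positive L = Literal.polarity L ≡ pos
Negative L = Literal.polarity L ≡ neg

mapLiteral : {T U : Set} → (T → U) → Literal T → Literal U
mapLiteral f (lit p s t) = lit p (f s) (f t)

-- Equations are unoriented.
infix 4 _≗_
data _≗_ {T : Set} : Rel (Literal T) 0ℓ where
  same    : ∀ {L} → L ≗ L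
  flipped : ∀ {p s t} → lit p s t ≗ lit p t s

literalSetoid : Set → Setoid 0ℓ 0ℓ
literalSetoid T = record
  { Carrier       = Literal T
  ; _≈_           = _≗_
  ; isEquivalence = record { refl = same ; sym = sym′ ; trans = trans′ }
  }
  where
  sym′ : ∀ {K L : Literal T} → K ≗ L → L ≗ K
  sym′ same    = same
  sym′ flipped = flipped

  trans′ : ∀ {K L M : Literal T} → K ≗ L → L ≗ M → K ≗ M
  trans′ same    q       = q
  trans′ flipped same    = flipped
  trans′ flipped flipped = same

-- Multisets are lists considered up to permutation; everything below is
-- stated modulo _≋_, the equality of multisets of unoriented literals.
Clause : Set → Set
Clause T = List (Literal T)

infix 4 _≋_
_≋_ : {T : Set} → Rel (Clause T) 0ℓ
_≋_ {T} = Permutation._↭_ (literalSetoid T)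

-- Length-lexicographic ordering.
ShortLex : {A : Set} → Rel A 0ℓ → Rel (List A) 0ℓ
ShortLex _≺_ s t =
  length t < length s ⊎ (length s ≡ length t × Lex-< _≡_ _≺_ t s)

-- Dershowitz–Manna extension of a strict order to multisets over a setoid.
MultisetExt : (X : Setoid 0ℓ 0ℓ) → Rel (Setoid.Carrier X) 0ℓ →
              Rel (List (Setoid.Carrier X)) 0ℓ
MultisetExt X _≻_ M N =
  ∃[ K ] ∃[ P ] ∃[ Q ]
    M ↭ K ++ P × N ↭ K ++ Q × P ≢ [] × All (λ q → Any (_≻ q) P) Q
  where open Permutation X using (_↭_)

-- The rules are used both over Σ and over Σ ∪ {⊥}.  A premise is therefore
-- an abstract object carrying a clause and its selected literals: selection in
-- a g-clause is inherited from the clause it is an instance of, and so is not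
-- a function of the g-clause alone.
module Inferences
  {A : Set} (_≻_ : Rel (List A) 0ℓ)
  {Premise : Set} (clause : Premise → Clause (List A))
  (Selected : Premise → Pred (Literal (List A)) 0ℓ)
  where

  NoneSelected : Premise → Clause (List A) → Set
  NoneSelected p C = All (λ L → ¬ Selected p L) C

  infix 3 _⊢_
  data _⊢_ : List Premise → Clause (List A) → Set where

    superposition : ∀ {p q C D E u₁ u₂ u₃ s t} →
      clause p ≋ (u₁ ++ u₂ ≈ s) ∷ C →
      clause q ≋ (u₂ ++ u₃ ≈ t) ∷ D →
      u₂ ≢ [] →
      NoneSelected p C → NoneSelected q D →
      (u₁ ++ u₂) ≻ s → (u₂ ++ u₃) ≻ t →
      E ≋ (u₁ ++ t ≈ s ++ u₃) ∷ C ++ D →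
      p ∷ q ∷ [] ⊢ E

    rewriting : ∀ {p q C D E ⋈ u₁ u₂ u₃ s t} →
      clause p ≋ lit ⋈ (u₁ ++ u₂ ++ u₃) s ∷ C →
      clause q ≋ (u₂ ≈ t) ∷ D →
      (⋈ ≡ neg → Selected p (lit ⋈ (u₁ ++ u₂ ++ u₃) s)) →
      (⋈ ≡ pos → NoneSelected p C) →
      NoneSelected q D →
      u₂ ≻ t →
      E ≋ lit ⋈ (u₁ ++ t ++ u₃) s ∷ C ++ D →
      p ∷ q ∷ [] ⊢ E

    equalityResolution : ∀ {p C E s} →
      clause p ≋ (s ≉ s) ∷ C →
      Selected p (s ≉ s) →
      E ≋ C →
      p ∷ [] ⊢ E

    paramodulation : ∀ {p q C D E u₁ u₂ u₃ s t} →
      clause p ≋ (s ≈ u₁ ++ u₂) ∷ C →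
      clause q ≋ (u₂ ++ u₃ ≈ t) ∷ D →
      u₂ ≢ [] →
      NoneSelected p C → Any Positive C →
      NoneSelected q D →
      s ≻ (u₁ ++ u₂) → (u₂ ++ u₃) ≻ t →
      E ≋ (s ++ u₃ ≈ u₁ ++ t) ∷ C ++ D →
      p ∷ q ∷ [] ⊢ E

    factoring : ∀ {p C E s t u} →
      clause p ≋ (s ≈ t) ∷ (s ++ u ≈ t ++ u) ∷ C →
      NoneSelected p C →
      E ≋ (s ++ u ≈ t ++ u) ∷ C →
      p ∷ [] ⊢ E

record Alphabet : Set₁ where
  field
    Letter             : Set
    _≺_                : Rel Letter 0ℓ
    isStrictTotalOrder : IsStrictTotalOrder _≡_ _≺_
    letters            : List Letter
    enumerates         : IsEnumeration (setoid Letter) letters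

module Strings (𝒜 : Alphabet) where

  open Alphabet 𝒜 public using (Letter; _≺_)

  Str : Set
  Str = List Letter

  StrClause : Set
  StrClause = Clause Str

  infix 4 _≻_
  _≻_ : Rel Str 0ℓ
  _≻_ = ShortLex _≺_

  record SelectionFunction : Set where
    field
      select   : (C : StrClause) → Any Negative C → Literal Str
      negative : ∀ C n → Negative (select C n)
      member   : ∀ C n → select C n ∈ₗ C
      cong     : ∀ {C D} m n → C ≋ D → select C m ≗ select D n

    Selected : StrClause → Pred (Literal Str) 0ℓ
    Selected C L = Σ[ n ∈ Any Negative C ] L ≗ select C n

  infixr 5 _·_ _▹_
  data GTerm : Set where
    bot : GTerm
    _·_ : Letter → GTerm → GTerm

  _▹_ : Str → GTerm → GTerm
  u ▹ t = foldr _·_ t u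

  toString : GTerm → List (Letter ₋)
  toString bot     = [ ⊥₋ ]
  toString (a · t) = letter a ∷ toString t

  GClause : Set
  GClause = Clause GTerm

  data IsGLiteral : Literal Str → Literal GTerm → Set where
    pos : ∀ {s t} w → IsGLiteral (s ≈ t) (s ▹ w ▹ bot ≈ t ▹ w ▹ bot)
    neg : ∀ {u v}   → IsGLiteral (u ≉ v) (u ▹ bot ≉ v ▹ bot)

  IsGClause : StrClause → GClause → Set
  IsGClause C C′ = ∃[ E ] Pointwise IsGLiteral C E × C′ ≋ E

  infix 4 _≻ˢ_ _≻ᵍ_ _≻ᶜ_
  _≻ˢ_ : Rel (List (Letter ₋)) 0ℓ
  _≻ˢ_ = ShortLex (_<₋_ _≺_)

  _≻ᵍ_ : Rel GTerm 0ℓ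
  s ≻ᵍ t = toString s ≻ˢ toString t

  toMultiset : Literal GTerm → List (List GTerm)
  toMultiset (s ≈ t) = [ s ] ∷ [ t ] ∷ []
  toMultiset (s ≉ t) = (s ∷ t ∷ []) ∷ []

  _≻ᶜ_ : Rel GClause 0ℓ
  C ≻ᶜ D = MultisetExt M₂ (MultisetExt M₁ (MultisetExt M₀ _≻ᵍ_))
                       (map toMultiset C) (map toMultiset D)
    where
    M₀ M₁ M₂ : Setoid 0ℓ 0ℓ
    M₀ = setoid GTerm
    M₁ = Permutation.↭-setoid M₀
    M₂ = Permutation.↭-setoid M₁

  record Interpretation : Set₁ where
    field
      _∼_           : Rel GTerm 0ℓ
      isEquivalence : IsEquivalence _∼_
      congruent     : ∀ a {s t} → s ∼ t → (a · s) ∼ (a · t)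

  module _ (I : Interpretation) where
    open Interpretation I

    TrueLiteral : Pred (Literal GTerm) 0ℓ
    TrueLiteral (s ≈ t) = s ∼ t
    TrueLiteral (s ≉ t) = ¬ s ∼ t

  infix 4 _⊨ᵍ_ _⊨ˢ_
  _⊨ᵍ_ : Interpretation → GClause → Set
  I ⊨ᵍ C = Any (TrueLiteral I) C

  _⊨ˢ_ : Interpretation → StrClause → Set
  I ⊨ˢ C = ∀ C′ → IsGClause C C′ → I ⊨ᵍ C′

  Satisfiable : Pred StrClause 0ℓ → Set₁
  Satisfiable S = Σ[ I ∈ Interpretation ] (∀ C → C ∈ S → I ⊨ˢ C)

  infix 4 _⊨_
  _⊨_ : List GClause → GClause → Set₁
  Cs ⊨ C = ∀ I → All (I ⊨ᵍ_) Cs → I ⊨ᵍ C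

  _IsGClauseOf_ : GClause → Pred StrClause 0ℓ → Set
  C′ IsGClauseOf S = ∃[ C ] C ∈ S × IsGClause C C′

  -- C follows from finitely many g-clauses of S that are smaller than B.
  FollowsBelow : Pred StrClause 0ℓ → GClause → GClause → Set₁
  FollowsBelow S B C =
    ∃[ Cs ] All (_IsGClauseOf S) Cs × Cs ⊨ C × All (B ≻ᶜ_) Cs

  RedundantClause : Pred StrClause 0ℓ → StrClause → Set₁
  RedundantClause S C = ∀ C′ → IsGClause C C′ → FollowsBelow S C′ C′

  module Saturation (sel : SelectionFunction) where

    open SelectionFunction sel using (Selected)
    open Inferences _≻_ id Selected public using (_⊢_)

    record GPremise : Set where
      field
        source    : StrClause
        gClause   : GClause
        isGClause : IsGClause source gClause

      clauseˢ : Clause (List (Letter ₋))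
      clauseˢ = map (mapLiteral toString) gClause

      Selectedᵍ : Pred (Literal (List (Letter ₋))) 0ℓ
      Selectedᵍ L = ∃[ u ] ∃[ v ] Selected source (u ≉ v) ×
                    L ≗ (toString (u ▹ bot) ≉ toString (v ▹ bot))

    open GPremise

    open Inferences _≻ˢ_ clauseˢ Selectedᵍ public
      using () renaming (_⊢_ to _⊢ᵍ_)

    IsGInstance : List StrClause → StrClause → List GPremise → GClause → Set
    IsGInstance Ps D Ps′ D′ =
      map source Ps′ ≡ Ps × IsGClause D D′ ×
      (Ps′ ⊢ᵍ map (mapLiteral toString) D′)

    IsMaximal : List GPremise → GPremise → Set
    IsMaximal Ps′ p =
      p ∈ₗ Ps′ × All (λ q → ¬ gClause q ≻ᶜ gClause p) Ps′

    RedundantInference : Pred StrClause 0ℓ → List StrClause → StrClause → Set₁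
    RedundantInference S Ps D =
      ∀ Ps′ D′ → IsGInstance Ps D Ps′ D′ →
      ∀ p → IsMaximal Ps′ p → FollowsBelow S (gClause p) D′

    Deduction : Pred StrClause 0ℓ → Pred StrClause 0ℓ → Set
    Deduction S T = ∃[ Ps ] ∃[ C ] All (_∈ S) Ps × (Ps ⊢ C) × T ≐ S ∪ (C ≋_)

    Deletion : Pred StrClause 0ℓ → Pred StrClause 0ℓ → Set₁
    Deletion S T = ∃[ D ] RedundantClause S D × T ≐ S ∖ (D ≋_)

    record IsDerivation (S : ℕ → Pred StrClause 0ℓ) : Set₁ where
      field
        -- each S i is a set of multisets, not merely of lists
        respects : ∀ i → S i Respects _≋_
        step     : ∀ i → Deduction (S i) (S (suc i)) ⊎ Deletion (S i) (S (suc i))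

    Limit : (ℕ → Pred StrClause 0ℓ) → Pred StrClause 0ℓ
    Limit S C = ∃[ i ] (∀ j → i ≤ j → C ∈ S j)

    IsFair : (ℕ → Pred StrClause 0ℓ) → Set₁
    IsFair S = ∀ Ps D → All (_∈ Limit S) Ps → Ps ⊢ D →
               RedundantInference (⋃ ℕ S) Ps D

{-# OPTIONS --safe #-}
module Submission where

-- Each rule is sound. For completeness, suppose □ is never derived. By well-founded
-- recursion on the g-term s, a rule s → t is produced by a positive g-clause s ≈ t ∨ C with maximal
-- literal s ≈ t if s is irreducible by the rules below s, the clause is false in the congruence these
-- rules generate, and all smaller g-clauses are true in it. No left-hand side is a suffix of another,
-- so rewriting is deterministic and confluence is immediate. A minimal false g-clause is not
-- redundant, hence comes from a persistent clause; it admits an inference with a producing clause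
-- (or equality resolution or factoring) with a false conclusion, unless the redex lies in the
-- instantiating string w, where reducing w gives a smaller false instance. By fairness the conclusion
-- follows from smaller, hence true, g-clauses: a contradiction. A clause with a negative literal
-- always has a selected one, so producing clauses, and premises acting through a positive literal,
-- are purely positive.

open import Defs
open import Level using (0ℓ; Lift; lift; lower) renaming (suc to lsuc)
open import Axiom.ExcludedMiddle using (ExcludedMiddle)
open import Data.Fin.Induction using (spo-wellFounded)
open import Data.List.Base using (List; []; _∷_; _++_; [_]; map; length; lookup)
open import Data.List.Properties using (∷-injective; map-++; ++-identityʳ; ++-assoc; ++-cancelʳ)
open import Data.List.Relation.Binary.Lex.Strict using (Lex-<; base; this; next; <-compare; <-transitive)
open import Data.List.Relation.Binary.Permutation.Homogeneous using (Permutation; refl; prep; swap; trans)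
import Data.List.Relation.Binary.Permutation.Setoid as SetoidPermutation
import Data.List.Relation.Binary.Permutation.Setoid.Properties as PermutationProperties
open import Data.List.Relation.Binary.Pointwise as Pointwise using (Pointwise; []; _∷_; Pointwise-≡⇒≡)
open import Data.List.Relation.Unary.All as All using (All; []; _∷_)
import Data.List.Relation.Unary.All.Properties as All
open import Data.List.Relation.Unary.Any as Any using (Any; here; there; index)
import Data.List.Relation.Unary.Any.Properties as Any
open import Data.Nat.Base using (ℕ; zero; suc; _+_; _∸_; _<_; _≤_; s≤s)
open import Data.Nat.Induction using (<-wellFounded)
import Data.Nat.Properties as ℕ
open import Data.Product.Base using (∃-syntax; Σ-syntax; _×_; _,_; proj₁; proj₂; map₂)
open import Data.Sum.Base using (_⊎_; inj₁; inj₂; [_,_]′)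
open import Function.Base using (flip; id; _∘_; _on_)
open import Function.Bundles using (_⇔_; mk⇔; module Equivalence)
open import Induction.WellFounded as WF using (Acc; acc; WellFounded)
open import Relation.Binary.Bundles using (Setoid)
open import Relation.Binary.Construct.Add.Infimum.Strict
  using (_<₋_; <₋-cmp-≡; <₋-trans) renaming ([_] to letter-<)
open import Relation.Binary.Construct.Closure.Equivalence as EqClosure using (EqClosure)
open import Relation.Binary.Construct.Closure.ReflexiveTransitive using (Star; ε; _◅_; _◅◅_)
open import Relation.Binary.Construct.Closure.Symmetric using (fwd; bwd)
open import Relation.Binary.Construct.Closure.Transitive as ⁺ using (TransClosure; _∷ʳ_)
import Relation.Binary.Construct.On as On
open import Relation.Binary.Core using (Rel; REL; _⇒_)
open import Relation.Binary.Definitions using (_Respects_; Transitive; tri<; tri≈; tri>)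
open import Relation.Binary.PropositionalEquality as ≡ using (_≡_; _≢_; subst; subst₂; resp₂; setoid)
open import Relation.Binary.Structures using (IsEquivalence; IsStrictTotalOrder)
open import Relation.Nullary.Construct.Add.Infimum using (_₋; []-injective) renaming ([_] to letter)
open import Relation.Nullary.Decidable.Core using (Dec; yes; no; map′; decidable-stable)
open import Relation.Nullary.Negation.Core using (¬_; contradiction)
open import Relation.Unary using (Pred; _∈_; ⋃)
open Inferences using (superposition; rewriting; equalityResolution; paramodulation; factoring)

-- Splitting elements off multisets over a setoid.

module ElementsOf (X : Setoid 0ℓ 0ℓ) where

  open Setoid X using () renaming (Carrier to A; _≈_ to _≈ˣ_; sym to ≈-sym)
  open SetoidPermutation X using (_↭_; ↭-refl; ↭-sym; ↭-trans; ↭-prep; ↭-swap)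
  open PermutationProperties X using (drop-∷)
  open import Data.List.Membership.Setoid X using () renaming (_∈_ to _∈ˣ_)

  ∈⇒↭ : ∀ {x xs} → x ∈ˣ xs → ∃[ ys ] xs ↭ x ∷ ys
  ∈⇒↭ (here x≈y) = _ , prep (≈-sym x≈y) ↭-refl
  ∈⇒↭ (there {y} x∈xs) with ∈⇒↭ x∈xs
  ... | ys , xs↭x∷ys = y ∷ ys , ↭-trans (↭-prep y xs↭x∷ys) (↭-swap y _ ↭-refl)

  drop-≈ : ∀ {x y xs ys} → x ≈ˣ y → x ∷ xs ↭ y ∷ ys → xs ↭ ys
  drop-≈ x≈y p = drop-∷ (↭-trans p (prep (≈-sym x≈y) ↭-refl))

-- Well-foundedness of the multiset extension.

module DershowitzManna (X : Setoid 0ℓ 0ℓ) (_≻_ : Rel (Setoid.Carrier X) 0ℓ)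
  (≻-resp : ∀ {y} → (λ x → x ≻ y) Respects Setoid._≈_ X) where

  open Setoid X using () renaming (Carrier to A; sym to ≈-sym; refl to ≈-refl)
  open SetoidPermutation X using (_↭_; ↭-refl; ↭-sym; ↭-trans; ↭-prep; ↭-swap)
  open PermutationProperties X
    using (++⁺ˡ; ++⁺ʳ; ++-comm; ↭-shift; ∈-resp-↭; drop-∷; ¬x∷xs↭[]) renaming (++-assoc to ↭-++-assoc)
  open ElementsOf X
  open import Data.List.Membership.Setoid X using () renaming (_∈_ to _∈ˣ_)

  -- One element is replaced by finitely many smaller ones; MultisetExt is contained in
  -- the transitive closure of this relation.
  infix 4 _◁_
  _◁_ : Rel (List A) 0ℓ
  N ◁ M = ∃[ x ] ∃[ K ] ∃[ Q ] M ↭ x ∷ K × N ↭ Q ++ K × All (x ≻_) Q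

  private
    Acc-resp-↭ : Acc _◁_ Respects _↭_
    Acc-resp-↭ M↭M′ (acc rs) =
      acc λ { (x , K , Q , M′↭ , N↭ , x≻Q) → rs (x , K , Q , ↭-trans M↭M′ M′↭ , N↭ , x≻Q) }

    acc-++ : ∀ {x M} → (∀ {q} → x ≻ q → ∀ M → Acc _◁_ M → Acc _◁_ (q ∷ M)) →
             ∀ {Q} → All (x ≻_) Q → Acc _◁_ M → Acc _◁_ (Q ++ M)
    acc-++ f []          a = a
    acc-++ f (x≻q ∷ x≻Q) a = f x≻q _ (acc-++ f x≻Q a)

    ◁-∷⁻ : ∀ {N x M} → N ◁ x ∷ M →
           (∃[ Q ] N ↭ Q ++ M × All (x ≻_) Q) ⊎ (∃[ N′ ] N ↭ x ∷ N′ × N′ ◁ M)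
    ◁-∷⁻ {x = x} (y , K , Q , x∷M↭y∷K , N↭Q++K , y≻Q)
      with ∈-resp-↭ (↭-sym x∷M↭y∷K) (here ≈-refl)
    ... | here y≈x =
      inj₁ (Q , ↭-trans N↭Q++K (++⁺ˡ Q (↭-sym (drop-≈ (≈-sym y≈x) x∷M↭y∷K))) , All.map (≻-resp y≈x) y≻Q)
    ... | there y∈M with ∈⇒↭ y∈M
    ... | K′ , M↭y∷K′ =
      inj₂ (Q ++ K′ , ↭-trans N↭Q++K (↭-trans (++⁺ˡ Q K↭x∷K′) (↭-shift Q K′))
           , y , K′ , Q , M↭y∷K′ , ↭-refl , y≻Q)
      where
      K↭x∷K′ : K ↭ x ∷ K′
      K↭x∷K′ = drop-∷ (↭-trans (↭-sym x∷M↭y∷K)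
                 (↭-trans (↭-prep x M↭y∷K′) (↭-swap x y ↭-refl)))

    -- Nested induction, on `x` outside and on `M` inside. Replacing `x` adds smaller elements one
    -- by one, each covered by the outer hypothesis; a step within `M` keeps `x` and is covered by
    -- the inner one.
    acc-∷ : ∀ {x} → Acc (flip _≻_) x → ∀ M → Acc _◁_ M → Acc _◁_ (x ∷ M)
    acc-∷ (acc rx) M (acc rM) = acc λ N◁ → [
        (λ (Q , N↭ , x≻Q) → Acc-resp-↭ (↭-sym N↭)
          (acc-++ (λ x≻q → acc-∷ (rx x≻q)) x≻Q (acc rM)))
      , (λ (N′ , N↭ , N′◁) → Acc-resp-↭ (↭-sym N↭) (acc-∷ (acc rx) N′ (rM N′◁)))
      ]′ (◁-∷⁻ N◁)

  ◁-wellFounded : WellFounded (flip _≻_) → WellFounded _◁_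
  ◁-wellFounded wf []      = acc λ { (_ , _ , _ , []↭ , _) → contradiction (↭-sym []↭) ¬x∷xs↭[] }
  ◁-wellFounded wf (x ∷ M) = acc-∷ (wf x) M (◁-wellFounded wf M)

  private
    partition : ∀ {p P} Q → All (λ q → Any (_≻ q) (p ∷ P)) Q →
      ∃[ Q₁ ] ∃[ Q₂ ] Q ↭ Q₁ ++ Q₂ × All (p ≻_) Q₁ × All (λ q → Any (_≻ q) P) Q₂
    partition []      []       = [] , [] , ↭-refl , [] , []
    partition (q ∷ Q) (d ∷ ds) with partition Q ds
    partition (q ∷ Q) (here p≻q ∷ ds) | Q₁ , Q₂ , Q↭ , a , b =
      q ∷ Q₁ , Q₂ , ↭-prep q Q↭ , p≻q ∷ a , b
    partition (q ∷ Q) (there d ∷ ds) | Q₁ , Q₂ , Q↭ , a , b =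
      Q₁ , q ∷ Q₂ , ↭-trans (↭-prep q Q↭) (↭-sym (↭-shift Q₁ Q₂)) , a , d ∷ b

    -- The elements of `P` are replaced one at a time, each by the elements of `Q` assigned to it;
    -- `P ≢ []` guarantees at least one step.
    MultisetExt⇒◁⁺ : ∀ P {M N} K Q → M ↭ K ++ P → N ↭ K ++ Q → P ≢ [] →
                     All (λ q → Any (_≻ q) P) Q → TransClosure _◁_ N M
    MultisetExt⇒◁⁺ []       K Q M↭ N↭ P≢[] dom = contradiction ≡.refl P≢[]
    MultisetExt⇒◁⁺ (p ∷ []) K Q M↭ N↭ _ dom =
      ⁺.[ p , K , Q , ↭-trans M↭ (++-comm K [ p ]) , ↭-trans N↭ (++-comm K Q)
        , All.map (λ { (here p≻q) → p≻q }) dom ]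
    MultisetExt⇒◁⁺ (p ∷ P@(_ ∷ _)) K Q M↭ N↭ _ dom =
      let Q₁ , Q₂ , Q↭ , p≻Q₁ , dom₂ = partition Q dom in
      MultisetExt⇒◁⁺ P (K ++ Q₁) Q₂ ↭-refl
        (↭-trans N↭ (↭-trans (++⁺ˡ K Q↭) (↭-sym (↭-++-assoc K Q₁ Q₂)))) (λ ()) dom₂
      ∷ʳ (p , K ++ P , Q₁ , ↭-trans M↭ (↭-shift K P)
         , ↭-trans (++⁺ʳ P (++-comm K Q₁)) (↭-++-assoc Q₁ K P) , p≻Q₁)

  wellFounded : WellFounded (flip _≻_) → WellFounded (flip (MultisetExt X _≻_))
  wellFounded wf = WF.Subrelation.wellFounded
    (λ { (K , P , Q , M↭ , N↭ , P≢[] , dom) → MultisetExt⇒◁⁺ P K Q M↭ N↭ P≢[] dom })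
    (⁺.wellFounded _ (◁-wellFounded wf))

-- Supplies `≻-resp` when multiset extensions are nested.
MultisetExt-resp : (X : Setoid 0ℓ 0ℓ) (_≻_ : Rel (Setoid.Carrier X) 0ℓ) → ∀ {N} →
  (λ M → MultisetExt X _≻_ M N) Respects SetoidPermutation._↭_ X
MultisetExt-resp X _≻_ M↭M′ (K , P , Q , M↭ , rest) =
  K , P , Q , SetoidPermutation.↭-trans X (SetoidPermutation.↭-sym X M↭M′) M↭ , rest

-- The length-lexicographic ordering on g-terms.

module TermOrder (𝒜 : Alphabet) where

  open Strings 𝒜
  open Alphabet 𝒜 using (isStrictTotalOrder; letters; enumerates)
  private module ≺ = IsStrictTotalOrder isStrictTotalOrder

  -- The enumeration pulls the precedence back to a strict partial order on a finite set of indices,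
  -- which is well founded.
  ≺-wellFounded : WellFounded _≺_
  ≺-wellFounded a = subst (Acc _≺_) (≡.sym (Any.lookup-index (enumerates a)))
    (acc-lookup (spo-wellFounded (On.isStrictPartialOrder (lookup letters) ≺.isStrictPartialOrder)
      (index (enumerates a))))
    where
    acc-lookup : ∀ {i} → Acc (_≺_ on lookup letters) i → Acc _≺_ (lookup letters i)
    acc-lookup {i} (acc rs) = acc λ {b} b≺ →
      subst (Acc _≺_) (≡.sym (Any.lookup-index (enumerates b)))
        (acc-lookup (rs (subst (_≺ lookup letters i) (Any.lookup-index (enumerates b)) b≺)))

  size : GTerm → ℕ
  size t = length (toString t)

  infix 4 _<ᵍ_ _≤ᵍ_ _<ˡ_

  -- A wrapper around _≻ᵍ_ from which Agda can infer the two terms.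
  record _<ᵍ_ (s t : GTerm) : Set where
    constructor fromᵍ
    field toᵍ : t ≻ᵍ s
  open _<ᵍ_ public

  _≤ᵍ_ _<ˡ_ : Rel GTerm 0ℓ
  s ≤ᵍ t = s <ᵍ t ⊎ s ≡ t
  s <ˡ t = size t ≡ size s × Lex-< _≡_ (_<₋_ _≺_) (toString s) (toString t)

  private
    size-≢0 : ∀ t → size t ≢ 0
    size-≢0 bot     ()
    size-≢0 (a · t) ()

    <ˡ-·⁻ : ∀ s {a t} → s <ˡ a · t →
            (∃[ b ] ∃[ s′ ] s ≡ b · s′ × b ≺ a × size s′ ≡ size t) ⊎ (∃[ s′ ] s ≡ a · s′ × s′ <ˡ t)
    <ˡ-·⁻ bot     {t = t} (eq , _) = contradiction (ℕ.suc-injective eq) (size-≢0 t)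
    <ˡ-·⁻ (b · s) (eq , this (letter-< b≺a))   = inj₁ (b , s , ≡.refl , b≺a , ≡.sym (ℕ.suc-injective eq))
    <ˡ-·⁻ (b · s) (eq , next ≡.refl s<t) = inj₂ (s , ≡.refl , ℕ.suc-injective eq , s<t)

    -- Nested induction on the first letter, then on the tail. When the first letter decreases, the
    -- tail may become any g-term of the same size, hence the assumption on all of these.
    <ˡ-acc-· : ∀ {n} → (∀ t → size t ≡ n → Acc _<ˡ_ t) →
               ∀ {a t} → Acc _≺_ a → size t ≡ n → Acc _<ˡ_ t → Acc _<ˡ_ (a · t)
    <ˡ-acc-· wf {a} (acc ra) ≡.refl (acc rt) = acc λ {s} s<a·t → [
        (λ (b , s′ , s≡ , b≺a , eq) → subst (Acc _<ˡ_) (≡.sym s≡) (<ˡ-acc-· wf (ra b≺a) eq (wf s′ eq)))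
      , (λ (s′ , s≡ , s′<t) → subst (Acc _<ˡ_) (≡.sym s≡)
          (<ˡ-acc-· wf (acc ra) (≡.sym (proj₁ s′<t)) (rt s′<t)))
      ]′ (<ˡ-·⁻ s s<a·t)

    <ˡ-acc : ∀ n t → size t ≡ n → Acc _<ˡ_ t
    <ˡ-acc n bot ≡.refl = acc λ
      { {bot}   (_ , this ())
      ; {bot}   (_ , next _ (base ()))
      ; {a · s} (eq , _) → contradiction (≡.sym (ℕ.suc-injective eq)) (size-≢0 s) }
    <ˡ-acc (suc n) (a · t) eq =
      <ˡ-acc-· (<ˡ-acc n) (≺-wellFounded a) (ℕ.suc-injective eq) (<ˡ-acc n t (ℕ.suc-injective eq))

    <ᵍ-acc : ∀ {n} → Acc _<_ n → ∀ {t} → size t ≡ n → Acc _<ˡ_ t → Acc _<ᵍ_ t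
    <ᵍ-acc (acc rn) ≡.refl (acc rt) = acc λ s<t → [
        (λ s<t → <ᵍ-acc (rn s<t) ≡.refl (<ˡ-acc _ _ ≡.refl))
      , (λ s<t → <ᵍ-acc (acc rn) (≡.sym (proj₁ s<t)) (rt s<t)) ]′ (toᵍ s<t)

  <ᵍ-wellFounded : WellFounded _<ᵍ_
  <ᵍ-wellFounded t = <ᵍ-acc (<-wellFounded (size t)) ≡.refl (<ˡ-acc _ t ≡.refl)

  <ᵍ-trans : Transitive _<ᵍ_
  <ᵍ-trans (fromᵍ s<t) (fromᵍ t<u) = fromᵍ (shortLex-trans s<t t<u)
    where
    shortLex-trans : ∀ {s t u} → t ≻ˢ s → u ≻ˢ t → u ≻ˢ s
    shortLex-trans (inj₁ p)        (inj₁ q)         = inj₁ (ℕ.<-trans p q)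
    shortLex-trans (inj₁ p)        (inj₂ (eq , q))  = inj₁ (subst (_ <_) (≡.sym eq) p)
    shortLex-trans (inj₂ (eq , p)) (inj₁ q)         = inj₁ (subst (_< _) eq q)
    shortLex-trans (inj₂ (eq , p)) (inj₂ (eq′ , q)) =
      inj₂ (≡.trans eq′ eq , <-transitive ≡.isEquivalence (resp₂ _) (<₋-trans _≺_ ≺.trans) p q)

  ≤ᵍ-<ᵍ-trans : ∀ {s t u} → s ≤ᵍ t → t <ᵍ u → s <ᵍ u
  ≤ᵍ-<ᵍ-trans (inj₁ p)    q = <ᵍ-trans p q
  ≤ᵍ-<ᵍ-trans (inj₂ ≡.refl) q = q

  ≤ᵍ-trans : ∀ {s t u} → s ≤ᵍ t → t ≤ᵍ u → s ≤ᵍ u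
  ≤ᵍ-trans p (inj₁ q)    = inj₁ (≤ᵍ-<ᵍ-trans p q)
  ≤ᵍ-trans p (inj₂ ≡.refl) = p

  toString-injective : ∀ {s t} → toString s ≡ toString t → s ≡ t
  toString-injective {bot}   {bot}   _ = ≡.refl
  toString-injective {a · s} {b · t} eq =
    ≡.cong₂ _·_ ([]-injective (proj₁ (∷-injective eq))) (toString-injective (proj₂ (∷-injective eq)))

  data Comparison (s t : GTerm) : Set where
    less    : s <ᵍ t → Comparison s t
    equal   : s ≡ t → Comparison s t
    greater : t <ᵍ s → Comparison s t

  compareᵍ : ∀ s t → Comparison s t
  compareᵍ s t with ℕ.<-cmp (size s) (size t)
  ... | tri< s<t _ _ = less (fromᵍ (inj₁ s<t))
  ... | tri> _ _ t<s = greater (fromᵍ (inj₁ t<s))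
  ... | tri≈ _ eq _ with <-compare ≡.sym (<₋-cmp-≡ _≺_ ≺.compare) (toString s) (toString t)
  ...   | tri< s<t _ _ = less (fromᵍ (inj₂ (≡.sym eq , s<t)))
  ...   | tri≈ _ s≡t _ = equal (toString-injective (Pointwise-≡⇒≡ s≡t))
  ...   | tri> _ _ t<s = greater (fromᵍ (inj₂ (eq , t<s)))

  <ᵍ-· : ∀ a {s t} → s <ᵍ t → a · s <ᵍ a · t
  <ᵍ-· a (fromᵍ (inj₁ p))        = fromᵍ (inj₁ (s≤s p))
  <ᵍ-· a (fromᵍ (inj₂ (eq , p))) = fromᵍ (inj₂ (≡.cong suc eq , next ≡.refl p))

  <ᵍ-▹ : ∀ x {s t} → s <ᵍ t → x ▹ s <ᵍ x ▹ t
  <ᵍ-▹ []      p = p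
  <ᵍ-▹ (a ∷ x) p = <ᵍ-· a (<ᵍ-▹ x p)

  t<a·t : ∀ a t → t <ᵍ a · t
  t<a·t a t = fromᵍ (inj₁ ℕ.≤-refl)

  t≤x▹t : ∀ x t → t ≤ᵍ x ▹ t
  t≤x▹t []      t = inj₂ ≡.refl
  t≤x▹t (a ∷ x) t = inj₁ (≤ᵍ-<ᵍ-trans (t≤x▹t x t) (t<a·t a (x ▹ t)))

  toString-▹ : ∀ x t → toString (x ▹ t) ≡ map letter x ++ toString t
  toString-▹ []      t = ≡.refl
  toString-▹ (a ∷ x) t = ≡.cong (letter a ∷_) (toString-▹ x t)

  ▹-++ : ∀ x y t → (x ++ y) ▹ t ≡ x ▹ y ▹ t
  ▹-++ []      y t = ≡.refl
  ▹-++ (a ∷ x) y t = ≡.cong (a ·_) (▹-++ x y t)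

  ·-injective : ∀ {a b s t} → a · s ≡ b · t → a ≡ b × s ≡ t
  ·-injective ≡.refl = ≡.refl , ≡.refl

  ▹bot-injective : ∀ x y → x ▹ bot ≡ y ▹ bot → x ≡ y
  ▹bot-injective []      []      _  = ≡.refl
  ▹bot-injective (a ∷ x) (b ∷ y) eq =
    ≡.cong₂ _∷_ (proj₁ (·-injective eq)) (▹bot-injective x y (proj₂ (·-injective eq)))

  size-▹ : ∀ x t → size (x ▹ t) ≡ length x + size t
  size-▹ []      t = ≡.refl
  size-▹ (a ∷ x) t = ≡.cong suc (size-▹ x t)

  private
    lex-cancel : ∀ s p t → length s ≡ length p →
      Lex-< _≡_ (_<₋_ _≺_) (toString (s ▹ t)) (toString (p ▹ t)) → Lex-< _≡_ _≺_ s p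
    lex-cancel []      []      t _ l = contradiction l (irrefl t)
      where
      irrefl : ∀ t → ¬ Lex-< _≡_ (_<₋_ _≺_) (toString t) (toString t)
      irrefl bot     (this ())
      irrefl bot     (next _ (base ()))
      irrefl (a · t) (this (letter-< a≺a)) = ≺.irrefl ≡.refl a≺a
      irrefl (a · t) (next _ l)     = irrefl t l
    lex-cancel (a ∷ s) (b ∷ p) t eq (this (letter-< a≺b))  = this a≺b
    lex-cancel (a ∷ s) (b ∷ p) t eq (next ≡.refl l) = next ≡.refl (lex-cancel s p t (ℕ.suc-injective eq) l)

  -- Turns ordering conditions on g-terms into those of the inferences on strings. For equal lengths
  -- the first difference comes before the common suffix `t`.
  ≻-cancel : ∀ {p s} t → s ▹ t <ᵍ p ▹ t → p ≻ s
  ≻-cancel {p} {s} t (fromᵍ (inj₁ l)) =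
    inj₁ (ℕ.+-cancelʳ-< (size t) (length s) (length p) (subst₂ _<_ (size-▹ s t) (size-▹ p t) l))
  ≻-cancel {p} {s} t (fromᵍ (inj₂ (eq , l))) = inj₂ (|p|≡|s| , lex-cancel s p t (≡.sym |p|≡|s|) l)
    where
    |p|≡|s| : length p ≡ length s
    |p|≡|s| = ℕ.+-cancelʳ-≡ (size t) _ _ (≡.trans (≡.sym (size-▹ p t)) (≡.trans eq (size-▹ s t)))

  ≤ᵍ⇒≯ᵍ : ∀ {s t} → s ≤ᵍ t → ¬ t <ᵍ s
  ≤ᵍ⇒≯ᵍ p q = WF.wf⇒irrefl (resp₂ _<ᵍ_) ≡.sym <ᵍ-wellFounded ≡.refl (≤ᵍ-<ᵍ-trans p q)

  -- Levi's lemma for the free monoid. It locates a redex relative to the boundary between a string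
  -- and the string instantiating it.
  suffixes-comparable : ∀ (as cs : Str) {bs ds} → as ++ bs ≡ cs ++ ds →
    (∃[ e ] as ≡ cs ++ e × ds ≡ e ++ bs) ⊎ (∃[ e ] cs ≡ as ++ e × bs ≡ e ++ ds)
  suffixes-comparable as       []       eq = inj₁ (as , ≡.refl , ≡.sym eq)
  suffixes-comparable []       (c ∷ cs) eq = inj₂ (c ∷ cs , ≡.refl , eq)
  suffixes-comparable (a ∷ as) (c ∷ cs) eq with ≡.refl , eq′ ← ∷-injective eq
    with suffixes-comparable as cs eq′
  ... | inj₁ (e , p , q) = inj₁ (e , ≡.cong (a ∷_) p , q)
  ... | inj₂ (e , p , q) = inj₂ (e , ≡.cong (a ∷_) p , q)

-- Clauses up to permutation and orientation.

module ≋ {T : Set} where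
  open SetoidPermutation (literalSetoid T) public using (↭-refl; ↭-sym; ↭-trans; ↭-prep; ↭-swap)
  open PermutationProperties (literalSetoid T) public
    using (All-resp-↭; Any-resp-↭; ++⁺)
  open ElementsOf (literalSetoid T) public

  flip-head : ∀ {p s t C D} → C ≋ lit {T} p s t ∷ D → C ≋ lit p t s ∷ D
  flip-head C≋ = ↭-trans C≋ (prep flipped ↭-refl)

  Positive-≗ : Positive {T} Respects _≗_
  Positive-≗ same    p = p
  Positive-≗ flipped p = p

  ≋[]⇒≡[] : {C : Clause T} → C ≋ [] → C ≡ []
  ≋[]⇒≡[] {[]}    _    = ≡.refl
  ≋[]⇒≡[] {_ ∷ _} C≋[] = contradiction C≋[] (PermutationProperties.¬x∷xs↭[] (literalSetoid T))

  Any⇒∷ : {P : Pred (Literal T) 0ℓ} {C : Clause T} → Any P C → ∃[ L ] ∃[ D ] C ≋ L ∷ D × P L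
  Any⇒∷ (here p) = _ , _ , ↭-refl , p
  Any⇒∷ {C = K ∷ C} (there a) with Any⇒∷ a
  ... | L , D , C≋ , p = L , K ∷ D , ↭-trans (↭-prep K C≋) (↭-swap K L ↭-refl) , p

-- Positions are permuted alike on both sides, so commutation for single elements is enough. It
-- serves both from clauses to g-clauses and back.
Permutation-Pointwise-commute : {A B : Set} {R : Rel A 0ℓ} {S : Rel B 0ℓ} {G : REL A B 0ℓ} →
  (∀ {a a′ b} → R a a′ → G a b → ∃[ b′ ] G a′ b′ × S b b′) →
  ∀ {as as′ bs} → Permutation R as as′ → Pointwise G as bs →
  ∃[ bs′ ] Pointwise G as′ bs′ × Permutation S bs bs′
Permutation-Pointwise-commute {R = R} {S} {G} commute = go
  where
  pw : ∀ {as as′ bs} → Pointwise R as as′ → Pointwise G as bs →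
       ∃[ bs′ ] Pointwise G as′ bs′ × Pointwise S bs bs′
  pw []       []       = [] , [] , []
  pw (r ∷ rs) (g ∷ gs) with commute r g | pw rs gs
  ... | b , g′ , s | bs , gs′ , ss = b ∷ bs , g′ ∷ gs′ , s ∷ ss

  go : ∀ {as as′ bs} → Permutation R as as′ → Pointwise G as bs →
       ∃[ bs′ ] Pointwise G as′ bs′ × Permutation S bs bs′
  go (refl rs) gs with pw rs gs
  ... | bs , gs′ , ss = bs , gs′ , refl ss
  go (prep r p) (g ∷ gs) with commute r g | go p gs
  ... | b , g′ , s | bs , gs′ , q = b ∷ bs , g′ ∷ gs′ , prep s q
  go (swap r₁ r₂ p) (g₁ ∷ g₂ ∷ gs) with commute r₁ g₁ | commute r₂ g₂ | go p gs
  ... | b₁ , g₁′ , s₁ | b₂ , g₂′ , s₂ | bs , gs′ , q =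
    b₂ ∷ b₁ ∷ bs , g₂′ ∷ g₁′ ∷ gs′ , swap s₁ s₂ q
  go (trans p q) gs with go p gs
  ... | bs , gs′ , p′ with go q gs′
  ... | bs′ , gs″ , q′ = bs′ , gs″ , trans p′ q′

-- Instances of clauses and their truth.

module GClauses (𝒜 : Alphabet) where

  open Strings 𝒜
  open TermOrder 𝒜
  open ≋

  private
    IsGLiteral-≗ˡ : ∀ {K K′ L} → K ≗ K′ → IsGLiteral K L → ∃[ L′ ] IsGLiteral K′ L′ × L ≗ L′
    IsGLiteral-≗ˡ same    g       = _ , g , same
    IsGLiteral-≗ˡ flipped (pos w) = _ , pos w , flipped
    IsGLiteral-≗ˡ flipped neg     = _ , neg , flipped

    IsGLiteral-≗ʳ : ∀ {K L L′} → L ≗ L′ → IsGLiteral K L → ∃[ K′ ] IsGLiteral K′ L′ × K ≗ K′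
    IsGLiteral-≗ʳ same    g       = _ , g , same
    IsGLiteral-≗ʳ flipped (pos w) = _ , pos w , flipped
    IsGLiteral-≗ʳ flipped neg     = _ , neg , flipped

  IsGClause-≋ˡ : ∀ {C D C′} → C ≋ D → IsGClause C C′ → IsGClause D C′
  IsGClause-≋ˡ C≋D (E , C~E , C′≋E) with Permutation-Pointwise-commute IsGLiteral-≗ˡ C≋D C~E
  ... | F , D~F , E≋F = F , D~F , ↭-trans C′≋E E≋F

  gClause-∷ : ∀ {K L C C′} → IsGLiteral K L → IsGClause C C′ → IsGClause (K ∷ C) (L ∷ C′)
  gClause-∷ g (E , C~E , C′≋E) = _ , g ∷ C~E , ↭-prep _ C′≋E

  gClause-++ : ∀ {C C′ D D′} → IsGClause C C′ → IsGClause D D′ → IsGClause (C ++ D) (C′ ++ D′)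
  gClause-++ (E , C~E , C′≋E) (F , D~F , D′≋F) =
    E ++ F , Pointwise.++⁺ C~E D~F , ++⁺ C′≋E D′≋F

  gClause-∷⁻ : ∀ {K C C′} → IsGClause (K ∷ C) C′ →
               ∃[ L ] ∃[ C₁ ] C′ ≋ L ∷ C₁ × IsGLiteral K L × IsGClause C C₁
  gClause-∷⁻ (_ , g ∷ C~E , C′≋E) = _ , _ , C′≋E , g , _ , C~E , ↭-refl

  gClause-++⁻ : ∀ C {D E′} → IsGClause (C ++ D) E′ →
                ∃[ C′ ] ∃[ D′ ] E′ ≋ C′ ++ D′ × IsGClause C C′ × IsGClause D D′
  gClause-++⁻ [] g = [] , _ , ↭-refl , ([] , [] , ↭-refl) , g
  gClause-++⁻ (K ∷ C) (_ , g ∷ C~E , E′≋E) with gClause-++⁻ C (_ , C~E , ↭-refl)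
  ... | C′ , D′ , E≋ , gC , gD = _ ∷ C′ , D′ , ↭-trans E′≋E (↭-prep _ E≋) , gClause-∷ g gC , gD

  -- Traces a literal chosen in a g-clause back to its source, by commuting permutations with the
  -- reversed instance relation.
  gClause-unmap : ∀ {C C′ L C₁} → IsGClause C C′ → C′ ≋ L ∷ C₁ →
                  ∃[ K ] ∃[ C₀ ] C ≋ K ∷ C₀ × IsGLiteral K L × IsGClause C₀ C₁
  gClause-unmap (E , C~E , C′≋E) C′≋L∷C₁
    with Permutation-Pointwise-commute {G = flip IsGLiteral} IsGLiteral-≗ʳ
           (↭-trans (↭-sym C′≋E) C′≋L∷C₁) (Pointwise.symmetric id C~E)
  ... | K ∷ C₀ , g ∷ C₁~C₀ , C≋ = K , C₀ , C≋ , g , _ , Pointwise.symmetric id C₁~C₀ , ↭-refl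

  gClause-positive : ∀ {C C′} → IsGClause C C′ → All Positive C → All Positive C′
  gClause-positive (E , C~E , C′≋E) +C = All-resp-↭ Positive-≗ (↭-sym C′≋E) (go C~E +C)
    where
    go : ∀ {C E} → Pointwise IsGLiteral C E → All Positive C → All Positive E
    go []             []          = []
    go (pos w ∷ C~E) (≡.refl ∷ +C) = ≡.refl ∷ go C~E +C

  module _ (I : Interpretation) where
    open Interpretation I renaming (_∼_ to infix 4 _∼_)
    open IsEquivalence isEquivalence using () renaming (sym to ∼-sym)

    TrueLiteral-≗ : TrueLiteral I Respects _≗_
    TrueLiteral-≗ same                p = p
    TrueLiteral-≗ (flipped {pos}) p = ∼-sym p
    TrueLiteral-≗ (flipped {neg}) p = p ∘ ∼-sym

    ⊨ᵍ-≋ : (I ⊨ᵍ_) Respects _≋_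
    ⊨ᵍ-≋ = Any-resp-↭ TrueLiteral-≗

    ⊨ˢ-≋ : (I ⊨ˢ_) Respects _≋_
    ⊨ˢ-≋ C≋D I⊨C D′ g = I⊨C D′ (IsGClause-≋ˡ (↭-sym C≋D) g)

    ▹-cong : ∀ x {s t} → s ∼ t → x ▹ s ∼ x ▹ t
    ▹-cong []      p = p
    ▹-cong (a ∷ x) p = congruent a (▹-cong x p)

  -- Soundness of the inference rules.

  module Soundness (sel : SelectionFunction) (I : Interpretation) where
    open Saturation sel
    open Interpretation I renaming (_∼_ to infix 4 _∼_)
    open IsEquivalence isEquivalence renaming (refl to ∼-refl; sym to ∼-sym; trans to ∼-trans)

    private
      -- Common to superposition and paramodulation: with the left premise instantiated by `u₃ ++ w`
      -- and the right one by `w` under the context `u₁`, both speak of the string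
      -- `u₁ ++ u₂ ++ u₃ ++ w`.
      superpose : ∀ u₁ u₂ u₃ s t w →
        (u₁ ++ u₂) ▹ (u₃ ++ w) ▹ bot ∼ s ▹ (u₃ ++ w) ▹ bot →
        (u₂ ++ u₃) ▹ w ▹ bot ∼ t ▹ w ▹ bot →
        (u₁ ++ t) ▹ w ▹ bot ∼ (s ++ u₃) ▹ w ▹ bot
      superpose u₁ u₂ u₃ s t w p q
        rewrite ▹-++ u₁ u₂ ((u₃ ++ w) ▹ bot) | ▹-++ u₃ w bot | ▹-++ u₂ u₃ (w ▹ bot)
              | ▹-++ u₁ t (w ▹ bot) | ▹-++ s u₃ (w ▹ bot)
        = ∼-trans (∼-sym (▹-cong I u₁ q)) p

      inside : ∀ u₁ u₂ u₃ t W → u₂ ▹ u₃ ▹ W ∼ t ▹ u₃ ▹ W →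
        (u₁ ++ u₂ ++ u₃) ▹ W ∼ (u₁ ++ t ++ u₃) ▹ W
      inside u₁ u₂ u₃ t W q
        rewrite ▹-++ u₁ (u₂ ++ u₃) W | ▹-++ u₂ u₃ W | ▹-++ u₁ (t ++ u₃) W | ▹-++ t u₃ W
        = ▹-cong I u₁ q

      true-instance : ∀ {p K K′ C C′} → p ≋ K ∷ C → I ⊨ˢ p → IsGLiteral K K′ → IsGClause C C′ →
                     TrueLiteral I K′ ⊎ I ⊨ᵍ C′
      true-instance p≋ I⊨p g gC = Any.toSum (I⊨p _ (IsGClause-≋ˡ (↭-sym p≋) (gClause-∷ g gC)))

      -- A true side clause is inherited by the conclusion; otherwise both main literals are true
      -- and `f` applies.
      combine : ∀ {p q K K′ L L′ M E C C′ D D′} → E ≋ M ∷ C′ ++ D′ →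
        p ≋ K ∷ C → I ⊨ˢ p → IsGLiteral K K′ → IsGClause C C′ →
        q ≋ L ∷ D → I ⊨ˢ q → IsGLiteral L L′ → IsGClause D D′ →
        (TrueLiteral I K′ → TrueLiteral I L′ → TrueLiteral I M) → I ⊨ᵍ E
      combine {K′ = K′} {L′ = L′} {M} {C′ = C′} {D′ = D′} E≋ p≋ I⊨p k gC q≋ I⊨q l gD f =
        ⊨ᵍ-≋ I (↭-sym E≋) (go (true-instance p≋ I⊨p k gC) (true-instance q≋ I⊨q l gD))
        where
        go : TrueLiteral I K′ ⊎ I ⊨ᵍ C′ → TrueLiteral I L′ ⊎ I ⊨ᵍ D′ → I ⊨ᵍ M ∷ C′ ++ D′
        go (inj₁ k) (inj₁ l) = here (f k l)
        go (inj₂ c) _        = there (Any.++⁺ˡ c)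
        go (inj₁ _) (inj₂ d) = there (Any.++⁺ʳ C′ d)

      gClause-conclusion : ∀ {M E E′} C {D} → E ≋ M ∷ C ++ D → IsGClause E E′ →
        ∃[ M′ ] ∃[ C′ ] ∃[ D′ ] E′ ≋ M′ ∷ C′ ++ D′ × IsGLiteral M M′ × IsGClause C C′ × IsGClause D D′
      gClause-conclusion C E≋ gE with gClause-∷⁻ (IsGClause-≋ˡ E≋ gE)
      ... | M′ , F , E′≋ , g , gF with gClause-++⁻ C gF
      ... | C′ , D′ , F≋ , gC , gD = M′ , C′ , D′ , ↭-trans E′≋ (↭-prep M′ F≋) , g , gC , gD

    ⊢-sound : ∀ {Ps E} → Ps ⊢ E → All (I ⊨ˢ_) Ps → I ⊨ˢ E
    ⊢-sound (superposition {C = C} {u₁ = u₁} {u₂} {u₃} {s} {t} p≋ q≋ _ _ _ _ _ E≋) (I⊨p ∷ I⊨q ∷ []) E′ gE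
      with gClause-conclusion C E≋ gE
    ... | _ , C′ , D′ , E′≋ , pos w , gC , gD =
      combine E′≋ p≋ I⊨p (pos (u₃ ++ w)) gC q≋ I⊨q (pos w) gD (superpose u₁ u₂ u₃ s t w)
    ⊢-sound (rewriting {C = C} {u₁ = u₁} {u₂} {u₃} {s} {t} p≋ q≋ _ _ _ _ E≋) (I⊨p ∷ I⊨q ∷ []) E′ gE
      with gClause-conclusion C E≋ gE
    ... | _ , C′ , D′ , E′≋ , pos w , gC , gD =
      combine E′≋ p≋ I⊨p (pos w) gC q≋ I⊨q (pos (u₃ ++ w)) gD
        (λ k l → ∼-trans (∼-sym (inside u₁ u₂ u₃ t (w ▹ bot)
          (subst₂ _∼_ (≡.cong (u₂ ▹_) (▹-++ u₃ w bot)) (≡.cong (t ▹_) (▹-++ u₃ w bot)) l))) k)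
    -- Negative literals receive no instantiating string, so the right premise is instantiated by
    -- `u₃` alone.
    ... | _ , C′ , D′ , E′≋ , neg , gC , gD =
      combine E′≋ p≋ I⊨p neg gC q≋ I⊨q (pos u₃) gD
        (λ k l m → k (∼-trans (inside u₁ u₂ u₃ t bot l) m))
    ⊢-sound (equalityResolution p≋ _ E≋) (I⊨p ∷ []) E′ gE =
      [ contradiction ∼-refl , id ]′ (true-instance p≋ I⊨p neg (IsGClause-≋ˡ E≋ gE))
    ⊢-sound (paramodulation {C = C} {u₁ = u₁} {u₂} {u₃} {s} {t} p≋ q≋ _ _ _ _ _ _ E≋) (I⊨p ∷ I⊨q ∷ []) E′ gE
      with gClause-conclusion C E≋ gE
    ... | _ , C′ , D′ , E′≋ , pos w , gC , gD =
      combine E′≋ p≋ I⊨p (pos (u₃ ++ w)) gC q≋ I⊨q (pos w) gD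
        -- Paramodulation is superposition with the first equation and the conclusion reversed.
        (λ k l → ∼-sym (superpose u₁ u₂ u₃ s t w (∼-sym k) l))
    ⊢-sound (factoring {s = s} {t} {u} p≋ _ E≋) (I⊨p ∷ []) E′ gE
      with gClause-∷⁻ (IsGClause-≋ˡ E≋ gE)
    -- Instantiating `s ≈ t` by `u ++ w` makes it coincide with the instance by `w` of the retained
    -- literal.
    ... | _ , C′ , E′≋ , pos w , gC = ⊨ᵍ-≋ I (↭-sym E′≋)
      ([ (λ st → here (subst₂ _∼_ (split s) (split t) st)) , id ]′
        (true-instance p≋ I⊨p (pos (u ++ w)) (gClause-∷ (pos w) gC)))
      where
      split : ∀ v → v ▹ (u ++ w) ▹ bot ≡ (v ++ u) ▹ w ▹ bot
      split v = ≡.trans (≡.cong (v ▹_) (▹-++ u w bot)) (≡.sym (▹-++ v u (w ▹ bot)))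

    step-sound : ∀ {S T} → Deduction S T ⊎ Deletion S T →
                 (∀ C → C ∈ S → I ⊨ˢ C) → (∀ C → C ∈ T → I ⊨ˢ C)
    step-sound (inj₁ (Ps , D , Ps⊆S , Ps⊢D , T⊆ , _)) I⊨S C C∈T with T⊆ C∈T
    ... | inj₁ C∈S = I⊨S C C∈S
    ... | inj₂ D≋C = ⊨ˢ-≋ I D≋C (⊢-sound Ps⊢D (All.map (I⊨S _) Ps⊆S))
    step-sound (inj₂ (_ , _ , T⊆ , _)) I⊨S C C∈T = I⊨S C (proj₁ (T⊆ C∈T))

    derivation-sound : ∀ {S} → IsDerivation S → (∀ C → C ∈ S 0 → I ⊨ˢ C) →
                       ∀ i C → C ∈ S i → I ⊨ˢ C
    derivation-sound d I⊨S₀ zero    = I⊨S₀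
    derivation-sound d I⊨S₀ (suc i) =
      step-sound (IsDerivation.step d i) (derivation-sound d I⊨S₀ i)

-- The ordering on g-clauses.

module ClauseOrder (𝒜 : Alphabet) where

  open Strings 𝒜
  open TermOrder 𝒜
  open ≋

  M₀ M₁ M₂ : Setoid 0ℓ 0ℓ
  M₀ = setoid GTerm
  M₁ = SetoidPermutation.↭-setoid M₀
  M₂ = SetoidPermutation.↭-setoid M₁

  private
    infix 4 _>₁_ _>₂_
    _>₁_ : Rel (List GTerm) 0ℓ
    _>₁_ = MultisetExt M₀ _≻ᵍ_
    _>₂_ : Rel (List (List GTerm)) 0ℓ
    _>₂_ = MultisetExt M₁ _>₁_

  ≻ᶜ-wellFounded : WellFounded (flip _≻ᶜ_)
  ≻ᶜ-wellFounded = On.wellFounded (map toMultiset)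
    (DershowitzManna.wellFounded M₂ _>₂_ (MultisetExt-resp M₁ _>₁_)
      (DershowitzManna.wellFounded M₁ _>₁_ (MultisetExt-resp M₀ _≻ᵍ_)
        (DershowitzManna.wellFounded M₀ _≻ᵍ_ (λ { ≡.refl p → p })
          (WF.Subrelation.wellFounded fromᵍ <ᵍ-wellFounded))))

  ≻ᶜ-asym : ∀ {C D} → C ≻ᶜ D → ¬ D ≻ᶜ C
  ≻ᶜ-asym p q = WF.wf⇒asym ≻ᶜ-wellFounded q p

  ≻ᶜ-irrefl : ∀ {C} → ¬ C ≻ᶜ C
  ≻ᶜ-irrefl p = ≻ᶜ-asym p p

  private
    toMultiset-≗ : ∀ {K L} → K ≗ L → Setoid._≈_ M₂ (toMultiset K) (toMultiset L)
    toMultiset-≗ same            = SetoidPermutation.↭-refl M₁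
    toMultiset-≗ (flipped {pos}) = SetoidPermutation.↭-swap M₁ _ _ (SetoidPermutation.↭-refl M₁)
    toMultiset-≗ (flipped {neg}) = prep
      (SetoidPermutation.↭-swap M₀ _ _ (SetoidPermutation.↭-refl M₀)) (SetoidPermutation.↭-refl M₁)

  ≻ᶜ-≋ˡ : ∀ {C C′ D} → C ≋ C′ → C ≻ᶜ D → C′ ≻ᶜ D
  ≻ᶜ-≋ˡ C≋C′ = MultisetExt-resp M₂ _>₂_
    (PermutationProperties.map⁺ (literalSetoid GTerm) M₂ toMultiset-≗ C≋C′)

  infix 3 _⋗_
  _⋗_ : Rel (Literal GTerm) 0ℓ
  K ⋗ L = toMultiset K >₂ toMultiset L

  ⋗-dominates : ∀ {K C C₁ D} → C ≋ K ∷ C₁ → All (K ⋗_) D → C ≻ᶜ D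
  ⋗-dominates {K} {C} {C₁} {D} C≋ K⋗D = ≻ᶜ-≋ˡ {D = D} (↭-sym C≋)
    ([] , map toMultiset (K ∷ C₁) , map toMultiset D , ↭-refl₂ , ↭-refl₂ , (λ ())
    , All.map⁺ (All.map here K⋗D))
    where ↭-refl₂ = SetoidPermutation.↭-refl M₂

  ⋗-replace : ∀ {K L C C₁} → C ≋ K ∷ C₁ → K ⋗ L → C ≻ᶜ L ∷ C₁
  ⋗-replace {K} {L} {C} {C₁} C≋ K⋗L = ≻ᶜ-≋ˡ {D = L ∷ C₁} (↭-sym C≋)
    (map toMultiset C₁ , [ toMultiset K ] , [ toMultiset L ] , ∷↭∷ʳ _ _ , ∷↭∷ʳ _ _ , (λ ())
    , here K⋗L ∷ [])
    where open PermutationProperties M₂ using (∷↭∷ʳ)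

  private
    singleton-> : ∀ {s t} → t <ᵍ s → [ s ] >₁ [ t ]
    singleton-> t<s = [] , _ , _ , ↭-refl₀ , ↭-refl₀ , (λ ()) , here (toᵍ t<s) ∷ []
      where ↭-refl₀ = SetoidPermutation.↭-refl M₀

    -- If `c` equals `a`, it is the common part and `b` is dropped. Hence a negative literal exceeds
    -- positive ones even when they share its term `a`.
    pair-> : ∀ {a b c} → c ≤ᵍ a → (a ∷ b ∷ []) >₁ [ c ]
    pair-> (inj₁ c<a)    = [] , _ , _ , ↭-refl₀ , ↭-refl₀ , (λ ()) , here (toᵍ c<a) ∷ []
      where ↭-refl₀ = SetoidPermutation.↭-refl M₀
    pair-> (inj₂ ≡.refl) = [ _ ] , [ _ ] , [] , ↭-refl₀ , ↭-refl₀ , (λ ()) , []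
      where ↭-refl₀ = SetoidPermutation.↭-refl M₀

  pos⋗pos : ∀ {a b c d} → c <ᵍ a ⊎ c <ᵍ b → d <ᵍ a ⊎ d <ᵍ b → a ≈ b ⋗ c ≈ d
  pos⋗pos {a} {b} c< d< =
    [] , _ , _ , ↭-refl₁ , ↭-refl₁ , (λ ()) , dom c< ∷ dom d< ∷ []
    where
    ↭-refl₁ = SetoidPermutation.↭-refl M₁
    dom : ∀ {c} → c <ᵍ a ⊎ c <ᵍ b → Any (_>₁ [ c ]) ([ a ] ∷ [ b ] ∷ [])
    dom = [ here ∘ singleton-> , there ∘ here ∘ singleton-> ]′

  neg⋗pos : ∀ {a b c d} → c ≤ᵍ a → d ≤ᵍ a → a ≉ b ⋗ c ≈ d
  neg⋗pos c≤a d≤a =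
    [] , _ , _ , ↭-refl₁ , ↭-refl₁ , (λ ()) , here (pair-> c≤a) ∷ here (pair-> d≤a) ∷ []
    where ↭-refl₁ = SetoidPermutation.↭-refl M₁

-- Rewriting and the congruences it generates.

module Rewriting (𝒜 : Alphabet) where

  open Strings 𝒜
  open TermOrder 𝒜

  data Step (Q : Rel GTerm 0ℓ) : Rel GTerm 0ℓ where
    root  : ∀ {s t} → Q s t → Step Q s t
    under : ∀ a {s t} → Step Q s t → Step Q (a · s) (a · t)

  Step-map : ∀ {Q Q′} → Q ⇒ Q′ → Step Q ⇒ Step Q′
  Step-map f (root q)    = root (f q)
  Step-map f (under a q) = under a (Step-map f q)

  Step-redex : ∀ {Q s t} → Step Q s t → ∃[ x ] ∃[ q ] ∃[ r ] s ≡ x ▹ q × t ≡ x ▹ r × Q q r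
  Step-redex (root q) = [] , _ , _ , ≡.refl , ≡.refl , q
  Step-redex (under a p) with Step-redex p
  ... | x , q , r , ≡.refl , ≡.refl , Qqr = a ∷ x , q , r , ≡.refl , ≡.refl , Qqr

  Reducible : Rel GTerm 0ℓ → Pred GTerm 0ℓ
  Reducible Q s = ∃[ t ] Step Q s t

  interp : Rel GTerm 0ℓ → Interpretation
  interp Q = record
    { _∼_           = EqClosure (Step Q)
    ; isEquivalence = EqClosure.isEquivalence (Step Q)
    ; congruent     = λ a → EqClosure.gmap (a ·_) (under a)
    }

  infixl 6 _∣_
  _∣_ : Rel GTerm 0ℓ → Pred GTerm 0ℓ → Rel GTerm 0ℓ
  (Q ∣ K) s t = K s × Q s t

  Deterministic Decreasing : Pred (Rel GTerm 0ℓ) 0ℓ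
  Deterministic Q = ∀ {s t u} → Step Q s t → Step Q s u → t ≡ u
  Decreasing    Q = ∀ {s t} → Q s t → t <ᵍ s

  Step-decreasing : ∀ {Q} → Decreasing Q → ∀ {s t} → Step Q s t → t <ᵍ s
  Step-decreasing dec (root q)    = dec q
  Step-decreasing dec (under a p) = <ᵍ-· a (Step-decreasing dec p)

  -- The left-hand side applied is a suffix of `s`, hence at most `s`.
  Step-∣ : ∀ {Q s t K} → Step Q s t → (∀ {q} → q ≤ᵍ s → K q) → Step (Q ∣ K) s t
  Step-∣ (root q)    K≤ = root (K≤ (inj₂ ≡.refl) , q)
  Step-∣ (under a p) K≤ = under a (Step-∣ p (λ q≤s → K≤ (inj₁ (≤ᵍ-<ᵍ-trans q≤s (t<a·t a _)))))

  module Confluence {Q : Rel GTerm 0ℓ} (det : Deterministic Q) (dec : Decreasing Q) where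

    open Interpretation (interp Q) using () renaming (_∼_ to infix 4 _∼_)

    _⇝_ : Rel GTerm 0ℓ
    _⇝_ = Star (Step Q)

    private
      -- Steps are deterministic, so of two reductions from one term one continues the other.
      peak : ∀ {s t u} → s ⇝ t → s ⇝ u → ∃[ v ] t ⇝ v × u ⇝ v
      peak ε       q       = _ , q , ε
      peak (p ◅ ps) ε      = _ , ε , p ◅ ps
      peak (p ◅ ps) (q ◅ qs) with ≡.refl ← det p q = peak ps qs

    joinable : ∀ {s t} → s ∼ t → ∃[ u ] s ⇝ u × t ⇝ u
    joinable ε = _ , ε , ε
    joinable (fwd p ◅ ps) with joinable ps
    ... | u , q , r = u , p ◅ q , r
    joinable (bwd p ◅ ps) with joinable ps
    ... | u , q , r with peak (p ◅ ε) q
    ... | v , q′ , u⇝v = v , q′ , r ◅◅ u⇝v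

    ⇝-decreasing : ∀ {s t} → s ⇝ t → t ≤ᵍ s
    ⇝-decreasing ε        = inj₂ ≡.refl
    ⇝-decreasing (p ◅ ps) = inj₁ (≤ᵍ-<ᵍ-trans (⇝-decreasing ps) (Step-decreasing dec p))

    ∼⇒reducible : ∀ {s t} → s ∼ t → s ≡ t ⊎ Reducible Q s ⊎ Reducible Q t
    ∼⇒reducible s∼t with joinable s∼t
    ... | _ , p ◅ _ , _     = inj₂ (inj₁ (_ , p))
    ... | _ , ε     , q ◅ _ = inj₂ (inj₂ (_ , q))
    ... | _ , ε     , ε     = inj₁ ≡.refl

    -- An irreducible `t` would itself be the common reduct, so `s` would reduce to `t` and be at
    -- least as large.
    larger-reducible : ∀ {s t} → s ∼ t → s <ᵍ t → Reducible Q t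
    larger-reducible s∼t s<t with joinable s∼t
    ... | _ , _ , q ◅ _ = _ , q
    ... | _ , p , ε     = contradiction s<t (≤ᵍ⇒≯ᵍ (⇝-decreasing p))

    ⇝-∣ : ∀ {s t k} → s ⇝ t → s <ᵍ k → EqClosure (Step (Q ∣ (_<ᵍ k))) s t
    ⇝-∣ ε        s<k = ε
    ⇝-∣ (p ◅ ps) s<k = fwd (Step-∣ p (λ q≤s → ≤ᵍ-<ᵍ-trans q≤s s<k))
                     ◅ ⇝-∣ ps (<ᵍ-trans (Step-decreasing dec p) s<k)

    -- The two terms join by decreasing steps, which stay below `k` and thus use only rules with
    -- left-hand sides below `k`.
    ∼-∣ : ∀ {s t k} → s ∼ t → s <ᵍ k → t <ᵍ k → EqClosure (Step (Q ∣ (_<ᵍ k))) s t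
    ∼-∣ s∼t s<k t<k with joinable s∼t
    ... | u , p , q = ⇝-∣ p s<k ◅◅ EqClosure.symmetric _ (⇝-∣ q t<k)

-- Persistent and redundant clauses.

module Persistence (em : ExcludedMiddle (lsuc 0ℓ)) (𝒜 : Alphabet)
  (sel : Strings.SelectionFunction 𝒜) {S : ℕ → Pred (Strings.StrClause 𝒜) 0ℓ}
  (derivation : Strings.Saturation.IsDerivation 𝒜 sel S) where

  open Strings 𝒜
  open Saturation sel
  open GClauses 𝒜
  open ≋
  open IsDerivation derivation

  dec : (P : Set) → Dec P
  dec P = map′ lower lift (em {Lift (lsuc 0ℓ) P})

  RedundantClause-⊆ : ∀ {S T C} → (∀ {D} → D ∈ S → D ∈ T) → RedundantClause S C → RedundantClause T C
  RedundantClause-⊆ S⊆T red C′ g with red C′ g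
  ... | Cs , Cs∈S , rest = Cs , All.map (λ (C , C∈S , g) → C , S⊆T C∈S , g) Cs∈S , rest

  deleted-redundant : ∀ i {C} → C ∈ S i → ¬ C ∈ S (suc i) → RedundantClause (⋃ ℕ S) C
  deleted-redundant i C∈ C∉ with step i
  ... | inj₁ (_ , _ , _ , _ , _ , ⊆T) = contradiction (⊆T (inj₁ C∈)) C∉
  ... | inj₂ (D , red , _ , ⊆T) = RedundantClause-⊆ (i ,_)
    λ C′ g → red C′ (IsGClause-≋ˡ (↭-sym D≋C) g)
    where
    D≋C = decidable-stable (dec (D ≋ _)) (λ D≉C → C∉ (⊆T (C∈ , D≉C)))

  -- A search backwards from stage `k + i` finds a step at which `C` is deleted; redundancy at that
  -- stage carries over to the union.
  disappeared-redundant : ∀ i k {C} → C ∈ S i → ¬ C ∈ S (k + i) → RedundantClause (⋃ ℕ S) C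
  disappeared-redundant i zero    C∈ C∉ = contradiction C∈ C∉
  disappeared-redundant i (suc k) {C} C∈ C∉ with dec (C ∈ S (k + i))
  ... | yes C∈′ = deleted-redundant (k + i) C∈′ C∉
  ... | no  C∉′ = disappeared-redundant i k C∈ C∉′

  persistent⊎redundant : ∀ {C} → C ∈ ⋃ ℕ S → C ∈ Limit S ⊎ RedundantClause (⋃ ℕ S) C
  persistent⊎redundant {C} (i , C∈) with dec (∃[ k ] ¬ C ∈ S (k + i))
  ... | yes (k , C∉) = inj₂ (disappeared-redundant i k C∈ C∉)
  ... | no  ∄k = inj₁ (i , λ j i≤j → subst (λ n → C ∈ S n) (ℕ.m∸n+n≡m i≤j)
    (decidable-stable (dec _) (λ C∉ → ∄k (j ∸ i , C∉))))

  Minimal : Interpretation → Pred GClause 0ℓ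
  Minimal I C = ¬ I ⊨ᵍ C × (∀ E → E IsGClauseOf ⋃ ℕ S → C ≻ᶜ E → I ⊨ᵍ E)

  -- Serves redundant clauses and redundant inferences alike: the entailing g-clauses lie below `B`,
  -- so they are true.
  true-FollowsBelow : ∀ {I B C} → (∀ E → E IsGClauseOf ⋃ ℕ S → B ≻ᶜ E → I ⊨ᵍ E) →
                      FollowsBelow (⋃ ℕ S) B C → I ⊨ᵍ C
  true-FollowsBelow {I} below (Cs , Cs∈S , Cs⊨C , B≻Cs) =
    Cs⊨C I (All.zipWith (λ (E∈S , B≻E) → below _ E∈S B≻E) (Cs∈S , B≻Cs))

  minimal-persistent : ∀ {I C C′} → C ∈ ⋃ ℕ S → IsGClause C C′ → Minimal I C′ → C ∈ Limit S
  minimal-persistent C∈ g (C′-false , below) with persistent⊎redundant C∈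
  ... | inj₁ C∈L = C∈L
  ... | inj₂ red = contradiction (true-FollowsBelow below (red _ g)) C′-false

-- Lifting inferences from a minimal false g-clause.

module Refutation (em : ExcludedMiddle (lsuc 0ℓ)) (𝒜 : Alphabet)
  (sel : Strings.SelectionFunction 𝒜) {S : ℕ → Pred (Strings.StrClause 𝒜) 0ℓ}
  (derivation : Strings.Saturation.IsDerivation 𝒜 sel S)
  (fair : Strings.Saturation.IsFair 𝒜 sel S) where

  open Strings 𝒜
  open Saturation sel
  open GClauses 𝒜
  open TermOrder 𝒜
  open ClauseOrder 𝒜
  open ≋
  open Persistence em 𝒜 sel derivation
  open SelectionFunction sel using (Selected)
  open GPremise

  ≋-map : {T U : Set} (f : T → U) {C D : Clause T} → C ≋ D → map (mapLiteral f) C ≋ map (mapLiteral f) D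
  ≋-map f = PermutationProperties.map⁺ (literalSetoid _) (literalSetoid _)
    λ { same → same ; flipped → flipped }

  positive-NoneSelected : ∀ {C} → All Positive C → ∀ L → ¬ Selected C L
  positive-NoneSelected +C L (n , _) = absurd +C n
    where
    absurd : ∀ {C : StrClause} → All Positive C → ¬ Any Negative C
    absurd (≡.refl ∷ _)  (here ())
    absurd (_ ∷ +C) (there n) = absurd +C n

  private
    ++-[] : ∀ x {q} → toString (x ▹ q) ≡ map letter x ++ toString q ++ []
    ++-[] x {q} = ≡.trans (toString-▹ x q) (≡.cong (map letter x ++_) (≡.sym (++-identityʳ _)))

  -- Every g-term ends in ⊥, so overlaps between g-terms are at suffixes: superposition and
  -- paramodulation of g-clauses are the case u₃ = λ of rewriting.
  g-rewriting : ∀ (p p′ : GPremise) {⋈ x q r b C D} →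
    gClause p ≋ lit ⋈ (x ▹ q) b ∷ C → gClause p′ ≋ (q ≈ r) ∷ D →
    (⋈ ≡ neg → Selectedᵍ p (mapLiteral toString (lit ⋈ (x ▹ q) b))) →
    (⋈ ≡ pos → All Positive (source p)) → All Positive (source p′) → r <ᵍ q →
    p ∷ p′ ∷ [] ⊢ᵍ map (mapLiteral toString) (lit ⋈ (x ▹ r) b ∷ C ++ D)
  g-rewriting p p′ {⋈} {x} {q} {r} {b} {C} {D} p≋ p′≋ s⁻ s⁺ +p′ r<q =
    rewriting {u₁ = map letter x} {u₂ = toString q} {u₃ = []} {t = toString r}
      (subst (λ a → _ ≋ lit ⋈ a (toString b) ∷ map (mapLiteral toString) C) (++-[] x) (≋-map toString p≋))
      (≋-map toString p′≋)
      (λ eq → subst (λ a → Selectedᵍ p (lit ⋈ a (toString b))) (++-[] x) (s⁻ eq))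
      (λ eq → none p (s⁺ eq)) (none p′ +p′) (toᵍ r<q)
      (subst₂ (λ a F → lit ⋈ (toString (x ▹ r)) (toString b) ∷ map (mapLiteral toString) (C ++ D)
                       ≋ lit ⋈ a (toString b) ∷ F)
        (++-[] x) (map-++ (mapLiteral toString) C D) ↭-refl)
    where
    none : ∀ p → All Positive (source p) → ∀ {C} → All (λ L → ¬ Selectedᵍ p L) C
    none p +p = All.universal (λ { L (u , v , s , _) → positive-NoneSelected +p (u ≉ v) s }) _

  g-factoring : ∀ (p : GPremise) {s t C} →
    gClause p ≋ (s ≈ t) ∷ (s ≈ t) ∷ C → All Positive (source p) →
    p ∷ [] ⊢ᵍ map (mapLiteral toString) ((s ≈ t) ∷ C)
  g-factoring p {s} {t} {C} p≋ +p = factoring {s = toString s} {toString t} {[]}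
    (subst₂ (λ a b → _ ≋ (toString s ≈ toString t) ∷ (a ≈ b) ∷ map (mapLiteral toString) C)
      (≡.sym (++-identityʳ _)) (≡.sym (++-identityʳ _)) (≋-map toString p≋))
    (All.universal (λ { L (u , v , s , _) → positive-NoneSelected +p (u ≉ v) s }) _)
    (subst₂ (λ a b → (toString s ≈ toString t) ∷ map (mapLiteral toString) C
                     ≋ (a ≈ b) ∷ map (mapLiteral toString) C)
      (≡.sym (++-identityʳ _)) (≡.sym (++-identityʳ _)) ↭-refl)

  unary-true : ∀ {I C C′ E E′} → C ∈ ⋃ ℕ S → (g : IsGClause C C′) → Minimal I C′ →
    C ∷ [] ⊢ E → IsGClause E E′ →
    record { source = C ; gClause = C′ ; isGClause = g } ∷ [] ⊢ᵍ map (mapLiteral toString) E′ →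
    I ⊨ᵍ E′
  unary-true {I} {C} {C′} {E} {E′} C∈ g min@(_ , below) ⊢E gE ⊢ᵍE′ = true-FollowsBelow below
    (fair _ _ (minimal-persistent {I} C∈ g min ∷ []) ⊢E _ E′ (≡.refl , gE , ⊢ᵍE′) _
      (here ≡.refl , ≻ᶜ-irrefl {C′} ∷ []))

  -- The left premise is the maximal one by `D⊁C`, so fairness makes the conclusion follow from
  -- g-clauses below the minimal false `C′`.
  binary-true : ∀ {I C C′ D D′ E E′} → C ∈ ⋃ ℕ S → (g : IsGClause C C′) → Minimal I C′ →
    D ∈ Limit S → (h : IsGClause D D′) → ¬ D′ ≻ᶜ C′ →
    C ∷ D ∷ [] ⊢ E → IsGClause E E′ →
    record { source = C ; gClause = C′ ; isGClause = g }
      ∷ record { source = D ; gClause = D′ ; isGClause = h } ∷ [] ⊢ᵍ map (mapLiteral toString) E′ →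
    I ⊨ᵍ E′
  binary-true {I} {C} {C′} {D} {D′} {E} {E′} C∈ g min@(_ , below) D∈ h D⊁C ⊢E gE ⊢ᵍE′ =
    true-FollowsBelow below
      (fair _ _ (minimal-persistent {I} C∈ g min ∷ D∈ ∷ []) ⊢E _ E′ (≡.refl , gE , ⊢ᵍE′) _
        (here ≡.refl , ≻ᶜ-irrefl {C′} ∷ D⊁C ∷ []))

  -- What a rule `q → r` must provide to act as right premise. `I` may come from all rules or only
  -- from those below some term.
  record Producer (I : Interpretation) (q r : GTerm) : Set where
    open Interpretation I
    field
      {source′}   : StrClause
      {clause}    : GClause
      {rest}      : GClause
      persistent  : source′ ∈ Limit S
      isG         : IsGClause source′ clause
      positive    : All Positive source′
      clause≋     : clause ≋ (q ≈ r) ∷ rest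
      decreasing  : r <ᵍ q
      rest-false  : ¬ I ⊨ᵍ rest
      equation    : q ∼ r

  private
    IsGLiteral-pos⁻ : ∀ {K a b} → IsGLiteral K (a ≈ b) →
      ∃[ s ] ∃[ t ] ∃[ w ] K ≡ (s ≈ t) × a ≡ s ▹ w ▹ bot × b ≡ t ▹ w ▹ bot
    IsGLiteral-pos⁻ (pos w) = _ , _ , w , ≡.refl , ≡.refl , ≡.refl

    same-string : ∀ {a} s v t w → a ≡ s ▹ v ▹ bot → a ≡ t ▹ w ▹ bot → s ++ v ≡ t ++ w
    same-string s v t w p q = ▹bot-injective (s ++ v) (t ++ w)
      (≡.trans (▹-++ s v bot) (≡.trans (≡.sym p) (≡.trans q (≡.sym (▹-++ t w bot)))))

  module _ {I : Interpretation} where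
    open Interpretation I renaming (_∼_ to infix 4 _∼_)
    open IsEquivalence isEquivalence using () renaming (sym to ∼-sym; trans to ∼-trans)

    false-literal : ∀ {L C C₁} → ¬ I ⊨ᵍ C → C ≋ L ∷ C₁ → ¬ TrueLiteral I L
    false-literal C-false C≋ tL = C-false (⊨ᵍ-≋ I (↭-sym C≋) (here tL))

    false-rest : ∀ {L C C₁} → ¬ I ⊨ᵍ C → C ≋ L ∷ C₁ → ¬ I ⊨ᵍ C₁
    false-rest C-false C≋ tC₁ = C-false (⊨ᵍ-≋ I (↭-sym C≋) (there tC₁))

    -- Superposition, rewriting and paramodulation share one g-instance. Its conclusion would be
    -- true by fairness, yet the rewritten literal, the rest of `C′` and the rest of the producing
    -- clause are all false.
    no-binary-inference : ∀ {C C′ C₁ ⋈ x b q r M E C₀ D₀} → C ∈ ⋃ ℕ S → (g : IsGClause C C′) → Minimal I C′ →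
      C′ ≋ lit ⋈ (x ▹ q) b ∷ C₁ →
      (⋈ ≡ neg → ∃[ u ] ∃[ v ] Selected C (u ≉ v) × lit ⋈ (x ▹ q) b ≡ (u ▹ bot ≉ v ▹ bot)) →
      (⋈ ≡ pos → All Positive C) →
      (P : Producer I q r) → ¬ Producer.clause P ≻ᶜ C′ →
      ¬ TrueLiteral I (lit ⋈ (x ▹ r) b) →
      C ∷ Producer.source′ P ∷ [] ⊢ E → E ≋ M ∷ C₀ ++ D₀ →
      IsGLiteral M (lit ⋈ (x ▹ r) b) → IsGClause C₀ C₁ → ¬ IsGClause D₀ (Producer.rest P)
    no-binary-inference {C₁ = C₁} {x = x} C∈ g min C′≋ s⁻ s⁺ P D⊁C M-false ⊢E E≋ gM gC₀ gD₀ =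
      [ M-false , [ false-rest (proj₁ min) C′≋ , rest-false ]′ ∘ Any.++⁻ C₁ ]′
        (Any.toSum (binary-true {I} C∈ g min persistent isG D⊁C ⊢E
          (IsGClause-≋ˡ (↭-sym E≋) (gClause-∷ gM (gClause-++ gC₀ gD₀)))
          (g-rewriting _ _ {x = x} C′≋ clause≋
            (λ eq → let u , v , s , L≡ = s⁻ eq in u , v , s ,
              subst (λ L → mapLiteral toString L ≗ _) (≡.sym L≡) same)
            s⁺ positive decreasing)))
      where open Producer P

    all-rest : ∀ {K : Literal Str} {C C₀} → All Positive C → C ≋ K ∷ C₀ → All Positive C₀
    all-rest +C C≋ = All.tail (All-resp-↭ Positive-≗ C≋ +C)

    none-selected : ∀ {C C₀} → All Positive C → All (λ L → ¬ Selected C L) C₀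
    none-selected +C = All.universal (positive-NoneSelected +C) _

    -- The redex lies within the source string, within the instantiating string, or across their
    -- boundary. In the last case `ordered` decides between superposition, on the larger side, and
    -- paramodulation, on the smaller.
    reduce-positive : ∀ {C C′ C₁ a b x q r} → C ∈ ⋃ ℕ S → (g : IsGClause C C′) → Minimal I C′ →
      All Positive C → C′ ≋ (a ≈ b) ∷ C₁ → a ≡ x ▹ q →
      (P : Producer I q r) → ¬ Producer.clause P ≻ᶜ C′ → ¬ (b <ᵍ a ⊎ a <ᵍ b × C₁ ≢ [])
    reduce-positive {C} {C′} {C₁} {x = x} C∈ g min +C C′≋ a≡x▹q P D⊁C ordered
      with gClause-unmap g C′≋ | gClause-unmap (Producer.isG P) (Producer.clause≋ P)
    ... | _ , C₀ , C≋ , pos {s} {t} w , gC₀ | _ , D₀ , D≋ , pos {q} {r} v , gD₀ =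
      cases (suffixes-comparable s x s++w≡x++q++v)
      where
      open Producer P

      s++w≡x++q++v : s ++ w ≡ x ++ q ++ v
      s++w≡x++q++v = ▹bot-injective (s ++ w) (x ++ q ++ v) (≡.trans (▹-++ s w bot) (≡.trans a≡x▹q
        (≡.sym (≡.trans (▹-++ x (q ++ v) bot) (≡.cong (x ▹_) (▹-++ q v bot))))))

      q≻r : q ≻ r
      q≻r = ≻-cancel (v ▹ bot) decreasing

      infer : ∀ {E M} → C ∷ source′ ∷ [] ⊢ E → E ≋ M ∷ C₀ ++ D₀ →
              ¬ IsGLiteral M (x ▹ r ▹ v ▹ bot ≈ t ▹ w ▹ bot)
      infer ⊢E E≋ gM = no-binary-inference {x = x} C∈ g min
        (subst (λ a → C′ ≋ (a ≈ t ▹ w ▹ bot) ∷ C₁) a≡x▹q C′≋) (λ ()) (λ _ → +C) P D⊁C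
        (λ xr∼b → false-literal (proj₁ min) C′≋
          (subst (_∼ t ▹ w ▹ bot) (≡.sym a≡x▹q) (∼-trans (▹-cong I x equation) xr∼b)))
        ⊢E E≋ gM gC₀ gD₀

      -- The redex lies within w: replacing w by its reduct yields a smaller g-clause.
      in-substitution : ∀ y → ¬ w ≡ y ++ q ++ v
      in-substitution y ≡.refl = [ reduced-false , false-rest (proj₁ min) C′≋ ]′
        (Any.toSum (proj₂ min _ (C , C∈ , IsGClause-≋ˡ (↭-sym C≋) (gClause-∷ (pos (y ++ r ++ v)) gC₀))
          (⋗-replace {L = s ▹ (y ++ r ++ v) ▹ bot ≈ t ▹ (y ++ r ++ v) ▹ bot} C′≋
            (pos⋗pos (inj₁ (<ᵍ-▹ s w′<w)) (inj₂ (<ᵍ-▹ t w′<w))))))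
        where
        unfold : ∀ q → (y ++ q ++ v) ▹ bot ≡ y ▹ q ▹ v ▹ bot
        unfold q = ≡.trans (▹-++ y (q ++ v) bot) (≡.cong (y ▹_) (▹-++ q v bot))
        w′<w : (y ++ r ++ v) ▹ bot <ᵍ (y ++ q ++ v) ▹ bot
        w′<w = subst₂ _<ᵍ_ (≡.sym (unfold r)) (≡.sym (unfold q)) (<ᵍ-▹ y decreasing)
        w∼w′ : (y ++ q ++ v) ▹ bot ∼ (y ++ r ++ v) ▹ bot
        w∼w′ = subst₂ _∼_ (≡.sym (unfold q)) (≡.sym (unfold r)) (▹-cong I y equation)
        reduced-false : ¬ (s ▹ (y ++ r ++ v) ▹ bot ∼ t ▹ (y ++ r ++ v) ▹ bot)
        reduced-false s∼t = false-literal (proj₁ min) C′≋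
          (∼-trans (▹-cong I s w∼w′) (∼-trans s∼t (∼-sym (▹-cong I t w∼w′))))

      by-rewriting : ∀ e → s ≡ x ++ q ++ e → ¬ v ≡ e ++ w
      by-rewriting e ≡.refl ≡.refl = infer
        (rewriting {u₁ = x} {q} {e} {t} {r} C≋ D≋ (λ ()) (λ _ → none-selected +C) (none-selected positive)
          q≻r ↭-refl)
        ↭-refl
        (subst (λ a → IsGLiteral (x ++ r ++ e ≈ t) (a ≈ t ▹ w ▹ bot))
          (≡.trans (▹-++ x (r ++ e) (w ▹ bot)) (≡.cong (x ▹_)
            (≡.trans (▹-++ r e (w ▹ bot)) (≡.cong (r ▹_) (≡.sym (▹-++ e w bot))))))
          (pos w))

      by-overlap : ∀ e e′ → e ≢ [] → s ≡ x ++ e → q ≡ e ++ e′ → ¬ w ≡ e′ ++ v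
      by-overlap e e′ e≢[] ≡.refl ≡.refl ≡.refl = [ superposed , paramodulated ]′ ordered
        where
        gM : IsGLiteral (x ++ r ≈ t ++ e′) (x ▹ r ▹ v ▹ bot ≈ t ▹ (e′ ++ v) ▹ bot)
        gM = subst₂ (λ a b → IsGLiteral (x ++ r ≈ t ++ e′) (a ≈ b))
          (▹-++ x r (v ▹ bot))
          (≡.trans (▹-++ t e′ (v ▹ bot)) (≡.cong (t ▹_) (≡.sym (▹-++ e′ v bot))))
          (pos v)
        superposed : ¬ t ▹ w ▹ bot <ᵍ s ▹ w ▹ bot
        superposed b<a = infer
          (superposition {u₁ = x} {e} {e′} {t} {r} C≋ D≋ e≢[] (none-selected +C) (none-selected positive)
            (≻-cancel (w ▹ bot) b<a) q≻r ↭-refl)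
          ↭-refl gM
        paramodulated : ¬ (s ▹ w ▹ bot <ᵍ t ▹ w ▹ bot × C₁ ≢ [])
        paramodulated (a<b , C₁≢[]) = infer
          -- The equation is read from its larger side `t`; the further positive literal that the
          -- rule demands comes from `C₁ ≢ []`.
          (paramodulation {u₁ = x} {e} {e′} {t} {r} (flip-head C≋) D≋ e≢[]
            (none-selected +C) (some-positive C₀ gC₀ (all-rest +C C≋)) (none-selected positive)
            (≻-cancel (w ▹ bot) a<b) q≻r ↭-refl)
          (flip-head ↭-refl) gM
          where
          some-positive : ∀ C₀ → IsGClause C₀ C₁ → All Positive C₀ → Any Positive C₀
          some-positive [] (_ , [] , C₁≋[]) _ =
            contradiction (≋[]⇒≡[] C₁≋[]) C₁≢[]
          some-positive (_ ∷ _) _ (+L ∷ _) = here +L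

      cases : (∃[ e ] s ≡ x ++ e × q ++ v ≡ e ++ w) ⊎ (∃[ e ] x ≡ s ++ e × w ≡ e ++ q ++ v) → _
      cases (inj₂ (e , _ , w≡)) = in-substitution e w≡
      cases (inj₁ (e , s≡ , eq)) with suffixes-comparable q e eq
      ... | inj₂ (e′ , e≡ , v≡) = by-rewriting e′ (≡.trans s≡ (≡.cong (x ++_) e≡)) v≡
      ... | inj₁ (e′ , q≡ , w≡) with e
      -- With an empty overlap the redex begins exactly where `w` begins.
      ...   | []    = in-substitution [] (≡.trans w≡ (≡.cong (_++ v) (≡.sym q≡)))
      ...   | c ∷ e = by-overlap (c ∷ e) e′ (λ ()) s≡ q≡ w≡

    -- No string is appended to negative literals, so the redex lies wholly within `u` or its
    -- extension by the producer's instance: `u` is `x ++ q ++ w` as a string, and only rewriting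
    -- arises.
    reduce-negative : ∀ {C C′ C₀ C₁ u v x q r} → C ∈ ⋃ ℕ S → (g : IsGClause C C′) → Minimal I C′ →
      Selected C (u ≉ v) → C ≋ (u ≉ v) ∷ C₀ → C′ ≋ (u ▹ bot ≉ v ▹ bot) ∷ C₁ → IsGClause C₀ C₁ →
      u ▹ bot ≡ x ▹ q → (P : Producer I q r) → ¬ ¬ Producer.clause P ≻ᶜ C′
    reduce-negative {C} {C′} {C₀} {C₁} {u} {v} {x} C∈ g min sel C≋ C′≋ gC₀ u≡x▹q P D⊁C
      with gClause-unmap (Producer.isG P) (Producer.clause≋ P)
    ... | _ , D₀ , D≋ , pos {q} {r} w , gD₀ = no-binary-inference {x = x} C∈ g min
        (subst (λ a → C′ ≋ (a ≉ v ▹ bot) ∷ C₁) u≡x▹q C′≋)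
        (λ _ → u , v , sel , ≡.cong (_≉ v ▹ bot) (≡.sym u≡x▹q)) (λ ()) P D⊁C
        (λ xr≁v → false-literal (proj₁ min) C′≋ (λ u∼v → xr≁v
          (∼-trans (∼-sym (▹-cong I x equation)) (subst (_∼ v ▹ bot) u≡x▹q u∼v))))
        (rewriting {u₁ = x} {q} {w} {v} {r} (subst (λ a → C ≋ (a ≉ v) ∷ C₀) u≡ C≋) D≋
          (λ _ → subst (λ a → Selected C (a ≉ v)) u≡ sel) (λ ()) (none-selected positive)
          (≻-cancel (w ▹ bot) decreasing) ↭-refl)
        ↭-refl
        (subst (λ a → IsGLiteral (x ++ r ++ w ≉ v) (a ≉ v ▹ bot)) (unfold r) neg) gC₀ gD₀
      where
      open Producer P
      unfold : ∀ q → (x ++ q ++ w) ▹ bot ≡ x ▹ q ▹ w ▹ bot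
      unfold q = ≡.trans (▹-++ x (q ++ w) bot) (≡.cong (x ▹_) (▹-++ q w bot))
      u≡ : u ≡ x ++ q ++ w
      u≡ = ▹bot-injective u (x ++ q ++ w) (≡.trans u≡x▹q (≡.sym (unfold q)))

    resolve-equality : ∀ {C C′ C₀ C₁ u v} → C ∈ ⋃ ℕ S → (g : IsGClause C C′) → Minimal I C′ →
      Selected C (u ≉ v) → C ≋ (u ≉ v) ∷ C₀ → C′ ≋ (u ▹ bot ≉ v ▹ bot) ∷ C₁ → IsGClause C₀ C₁ →
      u ▹ bot ≢ v ▹ bot
    resolve-equality {u = u} {v} C∈ g min sel C≋ C′≋ gC₀ u≡v with ≡.refl ← ▹bot-injective u v u≡v =
      false-rest (proj₁ min) C′≋ (unary-true {I} C∈ g min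
        (equalityResolution C≋ sel ↭-refl) gC₀
        (equalityResolution (≋-map toString C′≋) (u , u , sel , same) ↭-refl))

    -- Comparing the two left sides shows one source string to extend the other by some `e`;
    -- cancelling the common suffix on the right sides gives the same `e` there, as factoring
    -- requires.
    factor : ∀ {C C′ C₁ s t} → C ∈ ⋃ ℕ S → (g : IsGClause C C′) → Minimal I C′ →
      All Positive C → ¬ C′ ≋ (s ≈ t) ∷ (s ≈ t) ∷ C₁
    factor {C} {C′} {C₁} {s} {t} C∈ g min +C C′≋ with gClause-unmap g C′≋
    ... | K , C₀ , C≋ , gK , gC₀ with gClause-unmap gC₀ ↭-refl
    ... | K′ , C₂ , C₀≋ , gK′ , gC₂ = go gK gK′ (↭-trans C≋ (↭-prep K C₀≋))
      where
      infer : ∀ {K} → C ∷ [] ⊢ K ∷ C₂ → ¬ IsGLiteral K (s ≈ t)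
      infer ⊢E gK = false-rest (proj₁ min) C′≋
        (unary-true {I} C∈ g min ⊢E (gClause-∷ gK gC₂) (g-factoring _ C′≋ +C))

      apply : ∀ {s₀ t₀ s₁ t₁} e w → C ≋ (s₀ ≈ t₀) ∷ (s₁ ≈ t₁) ∷ C₂ → IsGLiteral (s₁ ≈ t₁) (s ≈ t) →
              s₁ ≡ s₀ ++ e → ¬ t₁ ++ w ≡ t₀ ++ e ++ w
      apply {s₀} {t₀} {s₁} {t₁} e w C≋ gK ≡.refl t≡
        with ≡.refl ← ++-cancelʳ w t₁ (t₀ ++ e) (≡.trans t≡ (≡.sym (++-assoc t₀ e w))) =
        infer (factoring {s = s₀} {t₀} {e} C≋ (none-selected +C) ↭-refl) gK

      go : ∀ {K K′} → IsGLiteral K (s ≈ t) → IsGLiteral K′ (s ≈ t) → ¬ C ≋ K ∷ K′ ∷ C₂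
      go gK gK′ C≋ with IsGLiteral-pos⁻ gK | IsGLiteral-pos⁻ gK′
      ... | s₀ , t₀ , w , ≡.refl , s≡ , t≡ | s₁ , t₁ , v , ≡.refl , s≡′ , t≡′
        with suffixes-comparable s₁ s₀ {v} {w} (same-string s₁ v s₀ w s≡′ s≡)
           | same-string t₀ w t₁ v t≡ t≡′
      ... | inj₁ (e , s₁≡ , ≡.refl) | eq = apply e v C≋ gK′ s₁≡ (≡.sym eq)
      ... | inj₂ (e , s₀≡ , ≡.refl) | eq = apply e w (↭-trans C≋ (↭-swap _ _ ↭-refl)) gK s₀≡ eq

-- Each new element lies below some old one, so a downward closed property is inherited.
MultisetExt-All : (X : Setoid 0ℓ 0ℓ) (let open Setoid X using (Carrier) renaming (_≈_ to _≈ˣ_))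
  {_≻_ : Rel Carrier 0ℓ} {P : Pred Carrier 0ℓ} → P Respects _≈ˣ_ →
  (∀ {x y} → x ≻ y → P x → P y) → ∀ {M N} → MultisetExt X _≻_ M N → All P M → All P N
MultisetExt-All X {P = P} resp down {M} {N} (K , P′ , Q , M↭ , N↭ , _ , dom) allM =
  All-resp-↭ resp (↭-sym N↭) (All.++⁺ (All.++⁻ˡ K allKP)
    (All.map (λ d → let p , x≻q = All.lookupAny (All.++⁻ʳ K allKP) d in down x≻q p) dom))
  where
  open SetoidPermutation X using (↭-sym)
  open PermutationProperties X using (All-resp-↭)
  allKP : All P (K ++ P′)
  allKP = All-resp-↭ resp M↭ allM

-- Maximal literals and bounds on terms.

module Bounds (𝒜 : Alphabet) where

  open Strings 𝒜
  open TermOrder 𝒜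
  open ClauseOrder 𝒜
  open ≋

  Within : GTerm → Pred (Literal GTerm) 0ℓ
  Within s (lit _ a b) = a ≤ᵍ s × b ≤ᵍ s

  Within-≗ : ∀ {s} → Within s Respects _≗_
  Within-≗ same    p       = p
  Within-≗ flipped (p , q) = q , p

  Within-≻ᶜ : ∀ {s C D} → C ≻ᶜ D → All (Within s) C → All (Within s) D
  Within-≻ᶜ {s} {C} {D} C≻D C≤ = All.map (within _) (All.map⁻
    (MultisetExt-All M₂
      (PermutationProperties.All-resp-↭ M₁ (PermutationProperties.All-resp-↭ M₀ (λ { ≡.refl p → p })))
      (MultisetExt-All M₁ (PermutationProperties.All-resp-↭ M₀ (λ { ≡.refl p → p }))
        (MultisetExt-All M₀ (λ { ≡.refl p → p }) (λ x≻y x≤s → inj₁ (smaller x≻y x≤s))))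
      C≻D (All.map⁺ (All.map (multiset _) C≤))))
    where
    smaller : ∀ {x y} → x ≻ᵍ y → x ≤ᵍ s → y <ᵍ s
    smaller x≻y (inj₁ x<s)    = <ᵍ-trans (fromᵍ x≻y) x<s
    smaller x≻y (inj₂ ≡.refl) = fromᵍ x≻y
    multiset : ∀ L → Within s L → All (All (_≤ᵍ s)) (toMultiset L)
    multiset (_ ≈ _) (p , q) = (p ∷ []) ∷ (q ∷ []) ∷ []
    multiset (_ ≉ _) (p , q) = (p ∷ q ∷ []) ∷ []
    within : ∀ L → All (All (_≤ᵍ s)) (toMultiset L) → Within s L
    within (_ ≈ _) ((p ∷ []) ∷ (q ∷ []) ∷ []) = p , q
    within (_ ≉ _) ((p ∷ q ∷ []) ∷ [])        = p , q

  -- L is not larger than s ≈ t, where t ≤ᵍ s.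
  Bounded : GTerm → GTerm → Pred (Literal GTerm) 0ℓ
  Bounded s t L@(lit _ a b) = Within s L × (a ≡ s → b ≤ᵍ t) × (b ≡ s → a ≤ᵍ t)

  private
    Bounded-self : ∀ {s t} → t ≤ᵍ s → Bounded s t (s ≈ t)
    Bounded-self t≤s = (inj₂ ≡.refl , t≤s) , (λ _ → inj₂ ≡.refl) , (λ { ≡.refl → inj₂ ≡.refl })

    Bounded-< : ∀ {s t s′ t′} → s <ᵍ s′ → ∀ L → Bounded s t L → Bounded s′ t′ L
    Bounded-< s<s′ _ ((a≤s , b≤s) , _) =
      (inj₁ (≤ᵍ-<ᵍ-trans a≤s s<s′) , inj₁ (≤ᵍ-<ᵍ-trans b≤s s<s′))
      , (λ { ≡.refl → contradiction s<s′ (≤ᵍ⇒≯ᵍ a≤s) })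
      , (λ { ≡.refl → contradiction s<s′ (≤ᵍ⇒≯ᵍ b≤s) })

    Bounded-≤ : ∀ {s t t′} → t ≤ᵍ t′ → ∀ L → Bounded s t L → Bounded s t′ L
    Bounded-≤ t≤t′ _ (w , f , g) = w , (λ e → ≤ᵍ-trans (f e) t≤t′) , (λ e → ≤ᵍ-trans (g e) t≤t′)

    -- Literals are compared by larger side first and smaller side second.
    insert : ∀ {s₀ t₀ s t C rest} → t₀ ≤ᵍ s₀ → C ≋ (s ≈ t) ∷ rest → t ≤ᵍ s → All (Bounded s t) rest →
      ∃[ s′ ] ∃[ t′ ] ∃[ rest′ ] (s₀ ≈ t₀) ∷ C ≋ (s′ ≈ t′) ∷ rest′ × t′ ≤ᵍ s′ × All (Bounded s′ t′) rest′
    insert {s₀} {t₀} {s} {t} t₀≤s₀ C≋ t≤s rest≤ with compareᵍ s₀ s | compareᵍ t₀ t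
    ... | less s₀<s    | _ = s , t , _ , ↭-trans (↭-prep _ C≋) (↭-swap _ _ ↭-refl) , t≤s
                           , Bounded-< s₀<s (s₀ ≈ t₀) (Bounded-self t₀≤s₀) ∷ rest≤
    ... | greater s<s₀ | _ = s₀ , t₀ , _ , ↭-prep _ C≋ , t₀≤s₀
                           , Bounded-< s<s₀ (s ≈ t) (Bounded-self t≤s)
                           ∷ All.map (λ {L} → Bounded-< s<s₀ L) rest≤
    ... | equal ≡.refl | less t₀<t =
      s , t , _ , ↭-trans (↭-prep _ C≋) (↭-swap _ _ ↭-refl) , t≤s
      , Bounded-≤ (inj₁ t₀<t) (s₀ ≈ t₀) (Bounded-self t₀≤s₀) ∷ rest≤
    ... | equal ≡.refl | equal ≡.refl =
      s , t , _ , ↭-trans (↭-prep _ C≋) (↭-swap _ _ ↭-refl) , t≤s , Bounded-self t₀≤s₀ ∷ rest≤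
    ... | equal ≡.refl | greater t<t₀ =
      s , t₀ , _ , ↭-prep _ C≋ , t₀≤s₀
      , Bounded-≤ (inj₁ t<t₀) (s ≈ t) (Bounded-self t≤s) ∷ All.map (λ {L} → Bounded-≤ (inj₁ t<t₀) L) rest≤

    orient : ∀ a b → ∃[ s ] ∃[ t ] (a ≈ b) ≗ (s ≈ t) × t ≤ᵍ s
    orient a b with compareᵍ a b
    ... | less a<b     = b , a , flipped , inj₁ a<b
    ... | equal ≡.refl = a , b , same , inj₂ ≡.refl
    ... | greater b<a  = a , b , same , inj₁ b<a

  maximal-literal : ∀ {C} → All Positive C → C ≢ [] →
    ∃[ s ] ∃[ t ] ∃[ rest ] C ≋ (s ≈ t) ∷ rest × t ≤ᵍ s × All (Bounded s t) rest
  maximal-literal []                    C≢[] = contradiction ≡.refl C≢[]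
  maximal-literal {(a ≈ b) ∷ []}        (≡.refl ∷ +C) _ with orient a b
  ... | s , t , eq , t≤s = s , t , [] , prep eq ↭-refl , t≤s , []
  maximal-literal {(a ≈ b) ∷ C@(_ ∷ _)} (≡.refl ∷ +C) _
    with orient a b | maximal-literal +C (λ ())
  ... | s₀ , t₀ , eq , t₀≤s₀ | s , t , rest , C≋ , t≤s , rest≤
    with insert t₀≤s₀ C≋ t≤s rest≤
  ... | s′ , t′ , rest′ , ≋′ , t′≤s′ , rest′≤ =
    s′ , t′ , rest′ , ↭-trans (prep eq ↭-refl) ≋′ , t′≤s′ , rest′≤

  Bounded⇒Within : ∀ {C s t rest} → C ≋ (s ≈ t) ∷ rest → t ≤ᵍ s → All (Bounded s t) rest → All (Within s) C
  Bounded⇒Within C≋ t≤s rest≤ =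
    All-resp-↭ Within-≗ (↭-sym C≋) ((inj₂ ≡.refl , t≤s) ∷ All.map proj₁ rest≤)

  -- Places clauses producing rules for subterms of `a` below `C`. The weak bound suffices because
  -- `neg⋗pos` tolerates equality.
  neg-dominates : ∀ {a b s C C₁ D} → C ≋ (a ≉ b) ∷ C₁ → s ≤ᵍ a → All Positive D → All (Within s) D → C ≻ᶜ D
  neg-dominates C≋ s≤a +D D≤ = ⋗-dominates C≋ (All.zipWith
    (λ { {_ ≈ _} (≡.refl , c≤ , d≤) → neg⋗pos (≤ᵍ-trans c≤ s≤a) (≤ᵍ-trans d≤ s≤a) }) (+D , D≤))

  pos-dominates : ∀ {a b s C C₁ D} → C ≋ (a ≈ b) ∷ C₁ → s <ᵍ a → All Positive D → All (Within s) D → C ≻ᶜ D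
  pos-dominates C≋ s<a +D D≤ = ⋗-dominates C≋ (All.zipWith
    (λ { {_ ≈ _} (≡.refl , c≤ , d≤) →
        pos⋗pos (inj₁ (≤ᵍ-<ᵍ-trans c≤ s<a)) (inj₁ (≤ᵍ-<ᵍ-trans d≤ s<a)) }) (+D , D≤))

-- Construction of the model.

module Model (em : ExcludedMiddle (lsuc 0ℓ)) (𝒜 : Alphabet)
  (sel : Strings.SelectionFunction 𝒜) {S : ℕ → Pred (Strings.StrClause 𝒜) 0ℓ}
  (derivation : Strings.Saturation.IsDerivation 𝒜 sel S)
  (fair : Strings.Saturation.IsFair 𝒜 sel S) (no-empty : ¬ (∃[ j ] [] ∈ S j)) where

  open Strings 𝒜
  open Saturation sel
  open GClauses 𝒜
  open TermOrder 𝒜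
  open ClauseOrder 𝒜
  open Bounds 𝒜
  open Rewriting 𝒜
  open ≋
  open Persistence em 𝒜 sel derivation
  open Refutation em 𝒜 sel derivation fair
  open SelectionFunction sel using (Selected; select; negative; member)

  interp-≈ : ∀ {Q Q′} → Q ⇒ Q′ → ∀ {s t} → TrueLiteral (interp Q) (s ≈ t) → TrueLiteral (interp Q′) (s ≈ t)
  interp-≈ f = EqClosure.map (Step-map f)

  interp-positive : ∀ {Q Q′ C} → Q ⇒ Q′ → All Positive C → interp Q ⊨ᵍ C → interp Q′ ⊨ᵍ C
  interp-positive f (≡.refl ∷ _) (here t)  = here (interp-≈ f t)
  interp-positive f (_ ∷ +C)     (there t) = there (interp-positive f +C t)

  interp-ext : ∀ {Q Q′ C} → Q ⇒ Q′ → Q′ ⇒ Q → interp Q ⊨ᵍ C → interp Q′ ⊨ᵍ C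
  interp-ext {Q} {Q′} f g = Any.map (λ {L} → literal L)
    where
    literal : ∀ L → TrueLiteral (interp Q) L → TrueLiteral (interp Q′) L
    literal (_ ≈ _) t = interp-≈ f t
    literal (_ ≉ _) t = t ∘ interp-≈ g

  -- `Q` stands for the rules below `s`; it is a parameter because these come from the same
  -- recursion.
  record Candidate (Q : Rel GTerm 0ℓ) (s t : GTerm) : Set where
    field
      {source′} : StrClause
      {clause}  : GClause
      {rest}    : GClause
      source∈     : source′ ∈ ⋃ ℕ S
      isG         : IsGClause source′ clause
      positive    : All Positive source′
      clause≋     : clause ≋ (s ≈ t) ∷ rest
      decreasing  : t <ᵍ s
      bounded     : All (Bounded s t) rest
      minimal     : Minimal (interp Q) clause
      irreducible : ¬ Reducible Q s

    clause-positive : All Positive clause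
    clause-positive = gClause-positive isG positive

    rest-positive : All Positive rest
    rest-positive = All.tail (All-resp-↭ Positive-≗ clause≋ clause-positive)

    within : All (Within s) clause
    within = Bounded⇒Within clause≋ (inj₁ decreasing) bounded

  -- Different accessibility proofs yield rule sets that are merely coextensive.
  Candidate-ext : ∀ {Q Q′ s t} → Q ⇒ Q′ → Q′ ⇒ Q → Candidate Q s t → Candidate Q′ s t
  Candidate-ext f g c = record
    { source∈     = source∈
    ; isG         = isG
    ; positive    = positive
    ; clause≋     = clause≋
    ; decreasing  = decreasing
    ; bounded     = bounded
    ; minimal     = proj₁ minimal ∘ interp-ext g f , λ E E∈ C≻E → interp-ext f g (proj₂ minimal E E∈ C≻E)
    ; irreducible = λ (t , p) → irreducible (t , Step-map g p)
    }
    where open Candidate c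

  -- Taking the least right-hand side makes the rules functional without a proof that ≻ᶜ is total.
  Least : Pred GTerm 0ℓ → Pred GTerm 0ℓ
  Least P t = P t × (∀ {u} → u <ᵍ t → ¬ P u)

  Least-ext : ∀ {P P′ : Pred GTerm 0ℓ} → (∀ {t} → P t → P′ t) → (∀ {t} → P′ t → P t) →
              ∀ {t} → Least P t → Least P′ t
  Least-ext f g (p , least) = f p , λ u<t p′ → least u<t (g p′)

  least-exists : ∀ (P : Pred GTerm 0ℓ) {t} → Acc _<ᵍ_ t → P t → ∃[ u ] Least P u
  least-exists P {t} (acc rs) p with dec (∃[ u ] u <ᵍ t × P u)
  ... | yes (u , u<t , Pu) = least-exists P (rs u<t) Pu
  ... | no ∄u              = t , p , λ u<t Pu → ∄u (_ , u<t , Pu)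

  rule : ∀ s → Acc _<ᵍ_ s → GTerm → Set
  rule s (acc rs) = Least (Candidate (λ a b → Σ[ a<s ∈ a <ᵍ s ] rule a (rs a<s) b) s)

  -- A record, so that Agda can infer s and t.
  record Rule (s t : GTerm) : Set where
    constructor mkRule
    field least-candidate : rule s (<ᵍ-wellFounded s) t

  rule-irrelevant : ∀ s (p p′ : Acc _<ᵍ_ s) {t} → rule s p t → rule s p′ t
  rule-irrelevant s (acc rs) (acc rs′) = Least-ext
    (Candidate-ext (λ (a<s , r) → a<s , rule-irrelevant _ (rs a<s) (rs′ a<s) r)
                   (λ (a<s , r) → a<s , rule-irrelevant _ (rs′ a<s) (rs a<s) r))
    (Candidate-ext (λ (a<s , r) → a<s , rule-irrelevant _ (rs′ a<s) (rs a<s) r)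
                   (λ (a<s , r) → a<s , rule-irrelevant _ (rs a<s) (rs′ a<s) r))

  Rule< : GTerm → Rel GTerm 0ℓ
  Rule< s = Rule ∣ (_<ᵍ s)

  -- The recursion equation of `Rule`, freed from accessibility proofs.
  Rule⇔Least : ∀ {s t} → Rule s t ⇔ Least (Candidate (Rule< s) s) t
  Rule⇔Least {s} {t} = mk⇔ (λ (mkRule r) → Equivalence.to (go (<ᵍ-wellFounded s)) r)
                           (λ l → mkRule (Equivalence.from (go (<ᵍ-wellFounded s)) l))
    where
    go : (p : Acc _<ᵍ_ s) → rule s p t ⇔ Least (Candidate (Rule< s) s) t
    go (acc rs) = mk⇔ (Least-ext (Candidate-ext to from) (Candidate-ext from to))
                      (Least-ext (Candidate-ext from to) (Candidate-ext to from))
      where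
      to : ∀ {a b} → Σ[ a<s ∈ a <ᵍ s ] rule a (rs a<s) b → Rule< s a b
      to (a<s , r) = a<s , mkRule (rule-irrelevant _ (rs a<s) (<ᵍ-wellFounded _) r)
      from : ∀ {a b} → Rule< s a b → Σ[ a<s ∈ a <ᵍ s ] rule a (rs a<s) b
      from (a<s , mkRule r) = a<s , rule-irrelevant _ (<ᵍ-wellFounded _) (rs a<s) r

  candidate : ∀ {s t} → Rule s t → Candidate (Rule< s) s t
  candidate r = proj₁ (Equivalence.to Rule⇔Least r)

  Candidate⇒Rule : ∀ {s t} → Candidate (Rule< s) s t → ∃[ u ] Rule s u
  Candidate⇒Rule {s} c = map₂ (Equivalence.from Rule⇔Least)
    (least-exists (Candidate (Rule< s) s) (<ᵍ-wellFounded _) c)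

  Rule-decreasing : Decreasing Rule
  Rule-decreasing r = Candidate.decreasing (candidate r)

  Rule-functional : ∀ {s t u} → Rule s t → Rule s u → t ≡ u
  Rule-functional {s} {t} {u} p q
    with Equivalence.to Rule⇔Least p | Equivalence.to Rule⇔Least q | compareᵍ t u
  ... | c , _ | _ , least | less t<u    = contradiction c (least t<u)
  ... | _     | _         | equal t≡u   = t≡u
  ... | _ , least | d , _ | greater u<t = contradiction d (least u<t)

  -- A redex in `s` has a left-hand side below `a · s`, hence belongs to the rules for which `a · s`
  -- had to be irreducible.
  Rule-root : ∀ {a s t u} → Rule (a · s) t → ¬ Step Rule s u
  Rule-root {a} {s} r p = Candidate.irreducible (candidate r)
    (_ , under a (Step-∣ p (λ q≤s → ≤ᵍ-<ᵍ-trans q≤s (t<a·t a s))))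

  Rule-deterministic : Deterministic Rule
  Rule-deterministic (root p)    (root q)    = Rule-functional p q
  Rule-deterministic (root p)    (under _ q) = contradiction q (Rule-root p)
  Rule-deterministic (under _ p) (root q)    = contradiction p (Rule-root q)
  Rule-deterministic (under a p) (under _ q) = ≡.cong (a ·_) (Rule-deterministic p q)

  ⊆-deterministic : ∀ {Q} → Q ⇒ Rule → Deterministic Q
  ⊆-deterministic Q⊆ p q = Rule-deterministic (Step-map Q⊆ p) (Step-map Q⊆ q)

  ⊆-decreasing : ∀ {Q} → Q ⇒ Rule → Decreasing Q
  ⊆-decreasing Q⊆ q = Rule-decreasing (Q⊆ q)

  module Sub {Q : Rel GTerm 0ℓ} (Q⊆ : Q ⇒ Rule) = Confluence (⊆-deterministic Q⊆) (⊆-decreasing Q⊆)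

  -- Persistence comes from minimality for the rules below `q`; falsity of the rest passes from all
  -- rules down to `Q` because the rest is positive.
  candidate-producer : ∀ {Q q r} → Q ⇒ Rule → Q q r → (c : Candidate (Rule< q) q r) →
    ¬ interp Rule ⊨ᵍ Candidate.rest c → Producer (interp Q) q r
  candidate-producer {Q} Q⊆ Qqr c rest-false = record
    { persistent = minimal-persistent {interp (Rule< _)} source∈ isG minimal
    ; isG        = isG
    ; positive   = positive
    ; clause≋    = clause≋
    ; decreasing = decreasing
    ; rest-false = λ t → rest-false (interp-positive Q⊆ rest-positive t)
    ; equation   = EqClosure.return (root Qqr)
    }
    where open Candidate c

  -- If the producing clause were larger, its minimality would make `C′` true by the rules below
  -- `q`, and so in `Q`.
  candidate-⊁ : ∀ {Q q r C C′} → Rule< q ⇒ Q → (c : Candidate (Rule< q) q r) →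
    C ∈ ⋃ ℕ S → IsGClause C C′ → All Positive C → ¬ interp Q ⊨ᵍ C′ → ¬ Candidate.clause c ≻ᶜ C′
  candidate-⊁ <q⊆ c C∈ g +C C′-false D≻C = C′-false (interp-positive <q⊆ (gClause-positive g +C)
    (proj₂ (Candidate.minimal c) _ (_ , C∈ , g) D≻C))

  -- If a further literal s ≈ u of the producing clause were true, then either u = t and factoring
  -- applies, or u <ᵍ t, so that t is reducible and paramodulation applies.
  rest-false : ∀ {s} → Acc _<ᵍ_ s → ∀ {t} → Rule s t → (c : Candidate (Rule< s) s t) →
               ¬ interp Rule ⊨ᵍ Candidate.rest c
  rest-false {s} (acc rs) {t} Rst c rest-true with Any⇒∷ rest-true
  ... | L , rest₁ , rest≋ , L-true =
    literal (All.head (All-resp-↭ Positive-≗ rest≋ rest-positive)) rest≋ L-true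
      (All.head (All-resp-↭ Bounded-≗ rest≋ bounded))
    where
    open Candidate c
    open Sub {Rule} id using () renaming (∼-∣ to restrict)
    open Sub {Rule< s} proj₂ using (larger-reducible)
    open Interpretation (interp Rule) using () renaming (_∼_ to infix 4 _∼_)

    Bounded-≗ : Bounded s t Respects _≗_
    Bounded-≗ same    p                   = p
    Bounded-≗ flipped ((a≤ , b≤) , f , g) = (b≤ , a≤) , g , f

    clause≋₂ : ∀ {K} → rest ≋ K ∷ rest₁ → clause ≋ (s ≈ t) ∷ K ∷ rest₁
    clause≋₂ rest≋ = ↭-trans clause≋ (↭-prep _ rest≋)

    literal-false : ∀ {K} → rest ≋ K ∷ rest₁ → ¬ TrueLiteral (interp (Rule< s)) K
    literal-false {K} rest≋ = false-literal {interp (Rule< s)} (proj₁ minimal)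
      (↭-trans (clause≋₂ rest≋) (↭-swap (s ≈ t) K ↭-refl))

    partner : ∀ {u} → rest ≋ (s ≈ u) ∷ rest₁ → s ∼ u → u <ᵍ s → ¬ u ≤ᵍ t
    partner rest≋ s∼u u<s (inj₂ ≡.refl) =
      factor {interp (Rule< s)} source∈ isG minimal positive (clause≋₂ rest≋)
    partner {u} rest≋ s∼u u<s (inj₁ u<t)
      -- `u` and `t` are both equal to `s` and lie below it, so their equality already holds by the
      -- rules below `s`.
      with larger-reducible
             (restrict (EqClosure.transitive _ (EqClosure.symmetric _ s∼u) (EqClosure.return (root Rst)))
               u<s decreasing)
             u<t
    ... | _ , p with Step-redex p
    ... | x , q , r , t≡x▹q , _ , q<s , Rqr =
      reduce-positive {interp (Rule< s)} {x = x} source∈ isG minimal positive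
        (flip-head clause≋) t≡x▹q
        -- The redex `q` lies below `s`, so induction applies to its producing clause.
        (candidate-producer proj₂ (q<s , Rqr) (candidate Rqr) (rest-false (rs q<s) Rqr (candidate Rqr)))
        (candidate-⊁ (λ (a<q , Rab) → <ᵍ-trans a<q q<s , Rab) (candidate Rqr)
          source∈ isG positive (proj₁ minimal))
        (inj₂ (decreasing , λ { ≡.refl → contradiction (≋[]⇒≡[] (↭-sym rest≋)) λ () }))

    literal : ∀ {K} → Positive K → rest ≋ K ∷ rest₁ → TrueLiteral (interp Rule) K → ¬ Bounded s t K
    -- An equation between terms below `s` would already be true by the rules below `s`, making the
    -- producing clause true there.
    literal {a ≈ b} ≡.refl rest≋ a∼b ((inj₁ a<s , inj₁ b<s) , _) =
      literal-false rest≋ (restrict a∼b a<s b<s)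
    literal {a ≈ b} ≡.refl rest≋ a∼b ((inj₂ ≡.refl , inj₂ ≡.refl) , _) = literal-false rest≋ ε
    literal {a ≈ b} ≡.refl rest≋ a∼b ((inj₂ ≡.refl , inj₁ b<s) , f , _) = partner rest≋ a∼b b<s (f ≡.refl)
    literal {a ≈ b} ≡.refl rest≋ a∼b ((inj₁ a<s , inj₂ ≡.refl) , _ , g) =
      partner (flip-head rest≋) (EqClosure.symmetric _ a∼b) a<s (g ≡.refl)

  producer : ∀ {Q q r} → Q ⇒ Rule → Q q r → Producer (interp Q) q r
  producer Q⊆ Qqr = candidate-producer Q⊆ Qqr (candidate (Q⊆ Qqr))
    (rest-false (<ᵍ-wellFounded _) (Q⊆ Qqr) (candidate (Q⊆ Qqr)))

  -- A false selected literal has equal sides in the congruence: they are identical, for equality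
  -- resolution, or one is reducible, for rewriting. `Q` covers both all rules and those below a
  -- term.
  minimal-positive : ∀ {Q C C′} → Q ⇒ Rule → C ∈ ⋃ ℕ S → IsGClause C C′ →
                     Minimal (interp Q) C′ → All Positive C
  minimal-positive {Q} {C} {C′} Q⊆ C∈ g min with dec (Any Negative C)
  ... | no ¬neg = All.map (λ {L} → positive L) (All.¬Any⇒All¬ C ¬neg)
    where
    positive : ∀ L → ¬ Negative L → Positive L
    positive (_ ≈ _) _ = ≡.refl
    positive (_ ≉ _) ¬n = contradiction ≡.refl ¬n
  ... | yes n with select C n in eq | negative C n | member C n
  ... | u ≉ v | ≡.refl | L∈C with ∈⇒↭ (Any.map (λ { ≡.refl → same }) L∈C)
  ... | C₀ , C≋ with gClause-∷⁻ (IsGClause-≋ˡ C≋ g)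
  ... | _ , C₁ , C′≋ , neg , gC₀ = contradiction u≁v (false-literal {interp Q} (proj₁ min) C′≋)
    where
    open Sub Q⊆ using (∼⇒reducible)
    selected : Selected C (u ≉ v)
    selected = n , subst ((u ≉ v) ≗_) (≡.sym eq) same

    reduce : ∀ u v → Selected C (u ≉ v) → C ≋ (u ≉ v) ∷ C₀ → C′ ≋ (u ▹ bot ≉ v ▹ bot) ∷ C₁ →
             ¬ Reducible Q (u ▹ bot)
    reduce u v sel C≋ C′≋ (_ , p) with Step-redex p
    ... | x , q , r , u≡x▹q , _ , Qqr =
      reduce-negative {interp Q} {x = x} C∈ g min sel C≋ C′≋ gC₀ u≡x▹q (producer Q⊆ Qqr)
        (≻ᶜ-asym {C′} {clause}
          (neg-dominates C′≋ (subst (q ≤ᵍ_) (≡.sym u≡x▹q) (t≤x▹t x q)) clause-positive within))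
      where open Candidate (candidate (Q⊆ Qqr))

    u≁v : ¬ TrueLiteral (interp Q) (u ▹ bot ≈ v ▹ bot)
    u≁v u∼v with ∼⇒reducible u∼v
    ... | inj₁ u≡v = resolve-equality {interp Q} C∈ g min selected C≋ C′≋ gC₀ u≡v
    ... | inj₂ (inj₁ red) = reduce u v selected C≋ C′≋ red
    ... | inj₂ (inj₂ red) = reduce v u (n , subst ((v ≉ u) ≗_) (≡.sym eq) flipped)
      (flip-head C≋) (flip-head C′≋) red

  -- The absence of the empty clause enters here, since a g-clause has as many literals as its
  -- source.
  gClause-nonempty : ∀ {C C′} → C ∈ ⋃ ℕ S → IsGClause C C′ → C′ ≢ []
  gClause-nonempty (i , []∈) (_ , [] , _) ≡.refl = no-empty (i , []∈)
  gClause-nonempty _ (_ , _ ∷ _ , []≋) ≡.refl = contradiction (≋[]⇒≡[] (↭-sym []≋)) λ ()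

  record Counterexample (Q : Rel GTerm 0ℓ) (C : GClause) : Set where
    field
      {source}   : StrClause
      source∈    : source ∈ ⋃ ℕ S
      isG        : IsGClause source C
      positive   : All Positive source
      minimal    : Minimal (interp Q) C
      {s t}      : GTerm
      {rest}     : GClause
      clause≋    : C ≋ (s ≈ t) ∷ rest
      decreasing : t <ᵍ s
      bounded    : All (Bounded s t) rest

    clause-positive : All Positive C
    clause-positive = gClause-positive isG positive

    within : All (Within s) C
    within = Bounded⇒Within clause≋ (inj₁ decreasing) bounded

  counterexample : ∀ {Q C′} → Q ⇒ Rule → C′ IsGClauseOf ⋃ ℕ S → Minimal (interp Q) C′ → Counterexample Q C′
  counterexample {Q} {C′} Q⊆ (C , C∈ , g) min with minimal-positive Q⊆ C∈ g min
  ... | +C with maximal-literal (gClause-positive g +C) (gClause-nonempty C∈ g)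
  ... | s , t , rest , C′≋ , t≤s , bounded = record
    { source∈ = C∈ ; isG = g ; positive = +C ; minimal = min ; clause≋ = C′≋ ; bounded = bounded
    -- A literal with identical sides would be true.
    ; decreasing = [ id , (λ { ≡.refl → contradiction ε (false-literal {interp Q} (proj₁ min) C′≋) }) ]′ t≤s }

  -- Classical descent along the clause ordering, which never enlarges the terms involved.
  minimal-below : ∀ {I s C} → Acc (flip _≻ᶜ_) C → C IsGClauseOf ⋃ ℕ S → All (Within s) C → ¬ I ⊨ᵍ C →
    ∃[ D ] D IsGClauseOf ⋃ ℕ S × All (Within s) D × Minimal I D
  minimal-below {I} {s} {C} (acc rs) C∈ C≤ C-false
    with dec (∃[ D ] D IsGClauseOf ⋃ ℕ S × C ≻ᶜ D × ¬ I ⊨ᵍ D)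
  ... | yes (D , D∈ , C≻D , D-false) = minimal-below (rs C≻D) D∈ (Within-≻ᶜ {s} {C} {D} C≻D C≤) D-false
  ... | no ∄D = C , C∈ , C≤ , C-false , λ D D∈ C≻D →
    decidable-stable (dec (I ⊨ᵍ D)) (λ D-false → ∄D (D , D∈ , C≻D , D-false))

  -- If the maximal term s is irreducible, the clause is still false before s is considered; a minimal
  -- such clause D would have produced a rule for s, or is already decided by the smaller rules.
  no-counterexample : ∀ {C} → ¬ Counterexample Rule C
  no-counterexample {C} c with dec (Reducible Rule (Counterexample.s c))
  ... | yes (_ , p) with Step-redex p
  ... | x , q , r , s≡x▹q , _ , Rqr =
    reduce-positive {interp Rule} {x = x} source∈ isG minimal positive clause≋ s≡x▹q (producer id Rqr)
      (candidate-⊁ proj₂ (candidate Rqr) source∈ isG positive (proj₁ minimal)) (inj₁ decreasing)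
    where open Counterexample c
  no-counterexample {C} c | no irreducible with
    minimal-below {interp (Rule< s)} {s} (≻ᶜ-wellFounded C) (_ , source∈ , isG) within
      (proj₁ minimal ∘ interp-positive proj₂ clause-positive)
    where open Counterexample c
  ... | D , D∈ , D≤ , D-min with counterexample proj₂ D∈ D-min
  ... | d = go (All.head (All-resp-↭ Within-≗ d.clause≋ D≤))
    where
    open Counterexample c
    module d = Counterexample d
    go : ¬ Within s (d.s ≈ d.t)
    go (inj₂ ≡.refl , _) = irreducible (map₂ root (Candidate⇒Rule (record
      { source∈ = d.source∈ ; isG = d.isG ; positive = d.positive ; clause≋ = d.clause≋
      ; decreasing = d.decreasing ; bounded = d.bounded ; minimal = d.minimal
      ; irreducible = λ (_ , p) → irreducible (_ , Step-map proj₂ p) })))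
    -- Here `D` is below `C`, so it is true under all rules; as its terms are below `s`, the rules
    -- below `s` already make it true.
    go (inj₁ d<s , _) = proj₁ d.minimal (restricted d.clause-positive d.within
      (proj₂ minimal D D∈ (pos-dominates clause≋ d<s d.clause-positive d.within)))
      where
      restricted : ∀ {E} → All Positive E → All (Within d.s) E → interp Rule ⊨ᵍ E → interp (Rule< s) ⊨ᵍ E
      restricted (≡.refl ∷ _) ((a≤ , b≤) ∷ _) (here a∼b) =
        here (Sub.∼-∣ {Rule} id a∼b (≤ᵍ-<ᵍ-trans a≤ d<s) (≤ᵍ-<ᵍ-trans b≤ d<s))
      restricted (_ ∷ +E) (_ ∷ E≤) (there t) = there (restricted +E E≤ t)

  all-true : ∀ {C} → Acc (flip _≻ᶜ_) C → C IsGClauseOf ⋃ ℕ S → interp Rule ⊨ᵍ C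
  all-true {C} (acc rs) C∈ = decidable-stable (dec (interp Rule ⊨ᵍ C)) λ C-false →
    no-counterexample (counterexample {Rule} id C∈ (C-false , λ E E∈ C≻E → all-true (rs C≻E) E∈))

  satisfiable : Satisfiable (S 0)
  satisfiable = interp Rule , λ C C∈ C′ g → all-true (≻ᶜ-wellFounded C′) (C , (0 , C∈) , g)

theorem19 : ExcludedMiddle (lsuc 0ℓ) →
    (𝒜 : Alphabet) → let open Strings 𝒜 in
    (sel : SelectionFunction) → let open Saturation sel in
    (S : ℕ → Pred StrClause 0ℓ) → IsDerivation S → IsFair S →
    (¬ Satisfiable (S 0)) ⇔ (∃[ j ] [] ∈ S j)
theorem19 em 𝒜 sel S derivation fair = mk⇔
  (λ unsat → decidable-stable (Persistence.dec em 𝒜 sel derivation _)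
    (λ no-empty → unsat (Model.satisfiable em 𝒜 sel derivation fair no-empty)))
  -- The empty clause has the empty g-clause as an instance, and no interpretation satisfies that.
  (λ (j , []∈) (I , I⊨S₀) → refuted (derivation-sound I derivation I⊨S₀ j [] []∈ [] ([] , [] , ≋.↭-refl)))
  where
  open Strings 𝒜
  open GClauses 𝒜
  open Soundness sel using (derivation-sound)
  refuted : ∀ {I} → ¬ I ⊨ᵍ []
  refuted ()
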